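{- If CH holds and $\kappa\ge\omega_2$ is a cardinal, then there is a $\sigma$-complete, $\omega_2$-c.c. poset $P$ such that in $V^P$ there is a function $g:[\kappa]^2\to\omega_1$ such that (1) $g$ establishes $\kappa\not\rightarrow[(\omega_1,\omega_2)]^2_{\omega_1}$, and (2) there is no uncountable $g$-rainbow subset of $\kappa$.
   Context: $[X]^2$ is the set of two-element subsets of $X$. For sets $A,B$ of ordinals, $[A,B]=\{\{\alpha,\beta\}:\alpha\in A,\ \beta\in B,\ \alpha\ne\beta\}$, and $g''[A,B]$ is the image of this set under $g$. A function $g:[\kappa]^2\to\omega_1$ establishes $\kappa\not\rightarrow[(\omega_1,\omega_2)]^2_{\omega_1}$ if $g''[A,B]=\omega_1$ for all $A,B\subseteq\kappa$ with $|A|=\omega_1$ and $|B|=\omega_2$ (no order relation between $A$ and $B$ is required). A set $R\subseteq\kappa$ is $g$-rainbow if $g\restriction[R]^2$ is one-to-one. A poset is $\sigma$-complete if every decreasing $\omega$-sequence of conditions has a lower bound; it is $\omega_2$-c.c. if every antichain has size at most $\omega_1$. $V^P$ denotes a generic extension of the ground model $V$ by $P$. -}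

module Defs where

open import Data.Nat using (ℕ; suc)
open import Data.Bool using (Bool)
open import Data.Product using (Σ; Σ-syntax; ∃-syntax; _×_; _,_; proj₁; proj₂)
open import Function.Bundles using (Bijection; Injection)
open import Induction.WellFounded using (WellFounded; Acc; acc)
open import Level using (Lift; 0ℓ) renaming (suc to lsuc)
open import Relation.Binary.Bundles using (Poset; Setoid; StrictTotalOrder)
open import Relation.Binary.PropositionalEquality using (_→-setoid_)
  renaming (setoid to ≡-setoid)
open import Relation.Nullary using (¬_)
open import Relation.Unary using (Pred)
import Relation.Binary.Construct.On as On

-- The ground model V is the universe Set, with setoids as its sets; a theorem
-- about V that uses ZFC takes excluded middle and function extensionality as
-- hypotheses.

----------------------------------------------------------------------
-- Cardinals and ordinals of the ground model

infix 4 _≼_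

_≼_ : Setoid 0ℓ 0ℓ → Setoid 0ℓ 0ℓ → Set
A ≼ B = Injection A B

subsetoid : (S : Setoid 0ℓ 0ℓ) → Pred (Setoid.Carrier S) 0ℓ → Setoid 0ℓ 0ℓ
subsetoid S A = On.setoid {B = Σ (Setoid.Carrier S) A} S proj₁

-- An ordinal is represented by any well-order of that order type.
record WellOrder : Set₁ where
  field
    strictTotalOrder : StrictTotalOrder 0ℓ 0ℓ 0ℓ
  open StrictTotalOrder strictTotalOrder public using (Carrier; _<_)
  field
    <-wellFounded : WellFounded _<_

∣_∣ : WellOrder → Setoid 0ℓ 0ℓ
∣ W ∣ = StrictTotalOrder.Eq.setoid (WellOrder.strictTotalOrder W)

below : (W : WellOrder) → WellOrder.Carrier W → Setoid 0ℓ 0ℓ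
below W a = subsetoid ∣ W ∣ (λ b → b < a)
  where open WellOrder W

-- Initial ordinals: no bijection with a smaller ordinal.
IsCardinal : WellOrder → Set
IsCardinal W = ∀ a → ¬ Bijection ∣ W ∣ (below W a)

-- W is the least ordinal that does not inject into S.  Thus ω₁ is the cardinal
-- successor of ℕ, and ω₂ that of ω₁.
IsCardinalSuccessor : Setoid 0ℓ 0ℓ → WellOrder → Set
IsCardinalSuccessor S W = ¬ (∣ W ∣ ≼ S) × (∀ a → below W a ≼ S)

Isω₁ : WellOrder → Set
Isω₁ = IsCardinalSuccessor (≡-setoid ℕ)

Isω₂ : WellOrder → WellOrder → Set
Isω₂ ω₁ = IsCardinalSuccessor ∣ ω₁ ∣

-- 2^ℵ₀ = ℵ₁
CH : WellOrder → Set
CH ω₁ = Bijection (ℕ →-setoid Bool) ∣ ω₁ ∣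

----------------------------------------------------------------------
-- Properties of posets

module _ (P : Poset 0ℓ 0ℓ 0ℓ) where
  open Poset P

  IsσComplete : Set
  IsσComplete = (p : ℕ → Carrier) → (∀ n → p (suc n) ≤ p n) →
                ∃[ q ] (∀ n → q ≤ p n)

  Compatible : Carrier → Carrier → Set
  Compatible p q = ∃[ r ] (r ≤ p × r ≤ q)

  IsAntichain : Pred Carrier 0ℓ → Set
  IsAntichain A = ∀ {p q} → A p → A q → ¬ (p ≈ q) → ¬ Compatible p q

  Isω₂-cc : WellOrder → Set₁
  Isω₂-cc ω₁ = (A : Pred Carrier 0ℓ) → IsAntichain A →
               subsetoid Eq.setoid A ≼ ∣ ω₁ ∣

----------------------------------------------------------------------
-- The first-order language of set theory

-- D supplies the parameters, and binders are functions on D.  All formulas below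
-- are written uniformly in D, so they are first-order formulas.
data Formula (D : Set₁) : Set₁ where
  _∈_ _≐_ : D → D → Formula D
  ¬′_     : Formula D → Formula D
  _∧_     : Formula D → Formula D → Formula D
  all     : (D → Formula D) → Formula D

infix  8 _∈_ _≐_
infix  7 ¬′_
infixr 6 _∧_
infixr 5 _∨_
infixr 4 _⇒_
infix  3 _⇔_
infixr 2 all ex allIn exIn

syntax all (λ x → φ) = ∀[ x ] φ

private variable
  D : Set₁

_∨_ _⇒_ _⇔_ : Formula D → Formula D → Formula D
φ ∨ ψ = ¬′ (¬′ φ ∧ ¬′ ψ)
φ ⇒ ψ = ¬′ (φ ∧ ¬′ ψ)
φ ⇔ ψ = (φ ⇒ ψ) ∧ (ψ ⇒ φ)

ex : (D → Formula D) → Formula D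
ex φ = ¬′ all (λ x → ¬′ φ x)

allIn exIn : D → (D → Formula D) → Formula D
allIn a φ = all (λ x → x ∈ a ⇒ φ x)
exIn  a φ = ex  (λ x → x ∈ a ∧ φ x)

syntax ex      (λ x → φ) = ∃[ x ]′ φ
syntax allIn a (λ x → φ) = ∀[ x ∈ a ] φ
syntax exIn  a (λ x → φ) = ∃[ x ∈ a ] φ

module _ {D : Set₁} where

  infix 8 _⊆_ _≐❴_,_❵ _≐⟨_,_⟩ _∈[_,_]

  _⊆_ : D → D → Formula D
  a ⊆ b = ∀[ x ∈ a ] x ∈ b

  _≐❴_,_❵ : D → D → D → Formula D
  z ≐❴ x , y ❵ = ∀[ w ] (w ∈ z ⇔ w ≐ x ∨ w ≐ y)

  _≐⟨_,_⟩ : D → D → D → Formula D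
  z ≐⟨ x , y ⟩ = ∃[ u ]′ ∃[ v ]′ (u ≐❴ x , x ❵ ∧ v ≐❴ x , y ❵ ∧ z ≐❴ u , v ❵)

  -- f(x) = y
  Maps : D → D → D → Formula D
  Maps f x y = ∃[ z ∈ f ] z ≐⟨ x , y ⟩

  IsFunction : D → D → D → Formula D
  IsFunction f a b =
      (∀[ z ∈ f ] ∃[ x ∈ a ] ∃[ y ∈ b ] z ≐⟨ x , y ⟩)
    ∧ (∀[ x ∈ a ] ∃[ y ∈ b ] (Maps f x y ∧ (∀[ y′ ∈ b ] (Maps f x y′ ⇒ y′ ≐ y))))

  IsInjective : D → Formula D
  IsInjective f =
    ∀[ x ] ∀[ x′ ] ∀[ y ] (Maps f x y ∧ Maps f x′ y ⇒ x ≐ x′)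

  InjectsInto : D → D → Formula D
  InjectsInto a b = ∃[ f ]′ (IsFunction f a b ∧ IsInjective f)

  Equinumerous : D → D → Formula D
  Equinumerous a b =
    ∃[ f ]′ (IsFunction f a b ∧ IsInjective f ∧ (∀[ y ∈ b ] ∃[ x ∈ a ] Maps f x y))

  -- Well-foundedness of ∈ on a is the axiom of foundation.
  IsOrdinal : D → Formula D
  IsOrdinal a =
      (∀[ x ∈ a ] x ⊆ a)
    ∧ (∀[ x ∈ a ] ∀[ y ∈ a ] (x ∈ y ∨ x ≐ y ∨ y ∈ x))

  IsInductive : D → Formula D
  IsInductive a =
      (∃[ z ∈ a ] ∀[ x ] ¬′ x ∈ z)
    ∧ (∀[ x ∈ a ] ∃[ y ∈ a ] ∀[ w ] (w ∈ y ⇔ w ∈ x ∨ w ≐ x))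

  Is-ω : D → Formula D
  Is-ω a = IsInductive a ∧ (∀[ b ] (IsInductive b ⇒ a ⊆ b))

  -- a is the least ordinal that does not inject into s.
  Is-CardinalSuccessor : D → D → Formula D
  Is-CardinalSuccessor s a =
    IsOrdinal a ∧ ¬′ InjectsInto a s ∧ (∀[ b ∈ a ] InjectsInto b s)

  -- z belongs to [A,B].  Taking A = B = X gives the two-element subsets of X,
  -- so [X]² is [X,X].
  _∈[_,_] : D → D → D → Formula D
  z ∈[ A , B ] = ∃[ α ∈ A ] ∃[ β ∈ B ] (¬′ α ≐ β ∧ z ≐❴ α , β ❵)

  IsPairFunction : D → D → D → Formula D
  IsPairFunction g κ b =
    ∃[ d ]′ ((∀[ z ] (z ∈ d ⇔ z ∈[ κ , κ ])) ∧ IsFunction g d b)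

  -- g″[A,B] = c
  ImageIs : D → D → D → D → Formula D
  ImageIs g A B c = ∀[ ξ ] (ξ ∈ c ⇔ (∃[ z ]′ (z ∈[ A , B ] ∧ Maps g z ξ)))

  -- g establishes κ ↛ [(ω₁,ω₂)]²_ω₁.
  Establishes : D → D → D → D → Formula D
  Establishes g κ ω₁ ω₂ =
      IsPairFunction g κ ω₁
    ∧ (∀[ A ] ∀[ B ]
        (A ⊆ κ ∧ B ⊆ κ ∧ Equinumerous A ω₁ ∧ Equinumerous B ω₂
          ⇒ ImageIs g A B ω₁))

  IsRainbow : D → D → Formula D
  IsRainbow g R =
    ∀[ z ] ∀[ z′ ] ∀[ ξ ]
      (z ∈[ R , R ] ∧ z′ ∈[ R , R ] ∧ Maps g z ξ ∧ Maps g z′ ξ ⇒ z ≐ z′)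

  NoUncountableRainbow : D → D → D → Formula D
  NoUncountableRainbow g κ ω =
    ¬′ (∃[ R ]′ (R ⊆ κ ∧ IsRainbow g R ∧ ¬′ InjectsInto R ω))

  -- ω, ω₁ and ω₂ are computed in the model where the formula is interpreted.
  ExistsColouring : D → Formula D
  ExistsColouring κ =
    ∃[ ω ]′ ∃[ ω₁ ]′ ∃[ ω₂ ]′
      ( Is-ω ω ∧ Is-CardinalSuccessor ω ω₁ ∧ Is-CardinalSuccessor ω₁ ω₂
      ∧ (∃[ g ]′ (Establishes g κ ω₁ ω₂ ∧ NoUncountableRainbow g κ ω)))

----------------------------------------------------------------------
-- Forcing

module Forcing (P : Poset 0ℓ 0ℓ 0ℓ) where
  open Poset P using (_≤_) renaming (Carrier to Condition)

  -- name I σ s is the P-name { (σ i , s i) : i ∈ I }.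
  data Name : Set₁ where
    name : (I : Set) → (I → Name) → (I → Condition) → Name

  infix 4 _⊩_∈̇_ _⊩_≐̇_ _⊩_

  -- p ⊩ σ ∈ τ when the conditions r that lie below some s with (π , s) in τ and
  -- r ⊩ σ = π are dense below p.
  mutual
    _⊩_∈̇_ : Condition → Name → Name → Set
    p ⊩ σ ∈̇ name J τ t =
      ∀ q → q ≤ p → ∃[ r ] (r ≤ q × ∃[ j ] (r ≤ t j × (r ⊩ σ ≐̇ τ j)))

    _⊩_≐̇_ : Condition → Name → Name → Set
    p ⊩ σ@(name I σ′ s) ≐̇ τ@(name J τ′ t) =
        (∀ i q → q ≤ p → q ≤ s i → q ⊩ σ′ i ∈̇ τ)
      × (∀ j q → q ≤ p → q ≤ t j → q ⊩ τ′ j ∈̇ σ)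

  _⊩_ : Condition → Formula Name → Set₁
  p ⊩ (σ ∈ τ) = Lift (lsuc 0ℓ) (p ⊩ σ ∈̇ τ)
  p ⊩ (σ ≐ τ) = Lift (lsuc 0ℓ) (p ⊩ σ ≐̇ τ)
  p ⊩ (¬′ φ)  = ∀ q → q ≤ p → ¬ (q ⊩ φ)
  p ⊩ (φ ∧ ψ) = (p ⊩ φ) × (p ⊩ ψ)
  p ⊩ all φ   = ∀ σ → p ⊩ φ σ

  -- φ holds in V^P, that is, in every generic extension by P.
  V^P⊨_ : Formula Name → Set₁
  V^P⊨ φ = ∀ p → p ⊩ φ

  -- The canonical name of the von Neumann ordinal of the order type of W.  There
  -- need not be a largest condition, so each element carries every condition.
  module _ (W : WellOrder) where
    open WellOrder W

    elementName : (a : Carrier) → Acc _<_ a → Name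
    elementName a (acc rs) =
      name (Σ Carrier (_< a) × Condition)
           (λ { ((b , b<a) , _) → elementName b (rs b<a) })
           proj₂

    check : Name
    check = name (Carrier × Condition)
                 (λ (a , _) → elementName a (<-wellFounded a))
                 proj₂

{-# OPTIONS --safe #-}

-- A condition is a countable partial colouring with countably many promises (A , C):
-- A is an infinite subset of the domain, C a countable set of colours, and every
-- point of the domain sends all but finitely many of its edges to A into C.  An
-- increasing union of countably many conditions is a condition.  Under CH, a Δ-system
-- argument finds among ω₂ conditions two that have the same type and agree on their
-- common part; they can be amalgamated, and one edge between their domains may still
-- be coloured arbitrarily.  This gives the ω₂-chain condition and (1).  For (2), decide
-- infinitely many elements α of an uncountable rainbow set R and promise that edges to
-- them have one of the colours C used so far.  Then each further β ∈ R has an edge of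
-- some colour in C to some α.  Since R is rainbow, the colour determines β, and since
-- no new countable sequences are added, R is contained in a countable set.
module Submission where

open import Defs
open import Axiom.ExcludedMiddle using (ExcludedMiddle)
open import Axiom.Extensionality.Propositional using (Extensionality; lower-extensionality)
open import Axiom.UniquenessOfIdentityProofs.WithK using (uip)
open import Data.Bool using (Bool; true; false; if_then_else_)
open import Data.Empty using (⊥; ⊥-elim)
open import Data.Nat using (ℕ; zero; suc; _+_; _∸_; _⊔_; s≤s)
import Data.Nat as ℕ
import Data.Nat.Induction as ℕ
import Data.Nat.Properties as ℕ
open import Data.Product using (Σ; Σ-syntax; ∃-syntax; _×_; _,_; proj₁; proj₂; uncurry; swap)
open import Data.Sum using (_⊎_; inj₁; inj₂; [_,_]′)
open import Function using (_∘_; id; case_of_)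
open import Function.Bundles using (Bijection; Injection)
open import Induction.WellFounded using (Acc; acc)
open import Level using (0ℓ; lift; lower) renaming (suc to lsuc)
open import Relation.Binary.Bundles using (Poset; Setoid; StrictTotalOrder)
open import Relation.Binary.Definitions using (tri<; tri≈; tri>)
open import Relation.Binary.PropositionalEquality
  using (_≡_; _≢_; refl; sym; trans; cong; cong₂; cong-app; subst; subst₂)
  renaming (setoid to ≡-setoid)
open import Relation.Nullary using (¬_; Dec; yes; no; does)
open import Relation.Nullary.Decidable using (map′; decidable-stable; dec-true; dec-false; toSum)

-- The two demands pull apart: (1) wants an edge that is free to take any colour, (2) wants edges
-- confined to countably many colours. Tolerating finitely many exceptions per point reconciles
-- them, since one free edge meets an injectively enumerated support at most once, while a single
-- obedient edge already suffices for (2). The colour `c₀` belongs to every promise, so edges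
-- without any other purpose can always receive it. CH is used in both directions. Colours, and with
-- them the types of conditions, become reals; and a family indexed injectively by reals has size at
-- most ω₁. Hence smallness always means being coded by reals. Countable sets are given as
-- sequences, so that two conditions can be compared position by position.

private variable
  X Y I J E T : Set

-- Reals and the enumeration of pairs of natural numbers.

𝒞 : Set
𝒞 = ℕ → Bool

-- Walks along the antidiagonals: from `(0 , s)` to `(s , 0)`, then on to `(0 , suc s)`.
next : ℕ × ℕ → ℕ × ℕ
next (m , zero)  = zero , suc m
next (m , suc n) = suc m , n

unpair : ℕ → ℕ × ℕ
unpair zero    = 0 , 0
unpair (suc k) = next (unpair k)

unpair-surjective : ∀ m n → ∃[ k ] unpair k ≡ (m , n)
unpair-surjective m n = go (m + n) m n refl
  where
  go : ∀ s m n → m + n ≡ s → ∃[ k ] unpair k ≡ (m , n)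
  go zero zero zero refl = 0 , refl
  go (suc s) zero (suc n) refl =
    let k , eq = go s s 0 (ℕ.+-identityʳ s) in suc k , cong next eq
  go s (suc m) n eq =
    let k , eq′ = go s m (suc n) (trans (ℕ.+-suc m n) eq) in suc k , cong next eq′

pair : ℕ → ℕ → ℕ
pair m n = proj₁ (unpair-surjective m n)

unpair-pair : ∀ m n → unpair (pair m n) ≡ (m , n)
unpair-pair m n = proj₂ (unpair-surjective m n)

flatten : (ℕ → ℕ → X) → ℕ → X
flatten f = uncurry f ∘ unpair

flatten-pair : (f : ℕ → ℕ → X) → ∀ m n → flatten f (pair m n) ≡ f m n
flatten-pair f m n = cong (uncurry f) (unpair-pair m n)

infixr 5 _◂_
_◂_ : X → (ℕ → X) → ℕ → X
(a ◂ s) zero    = a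
(a ◂ s) (suc n) = s n

-- Canonical representatives of setoid classes.

module Classical (em₁ : ExcludedMiddle (lsuc 0ℓ))
                 (ext₁ : Extensionality (lsuc 0ℓ) (lsuc 0ℓ)) where

  abstract
    em : ExcludedMiddle 0ℓ
    em = map′ lower lift em₁

  ext : Extensionality 0ℓ 0ℓ
  ext = lower-extensionality (lsuc 0ℓ) (lsuc 0ℓ) ext₁

  does-true : {P : Set} (d : Dec P) → does d ≡ true → P
  does-true (yes p) _ = p

  does-cong : {P Q : Set} → (P → Q) → (Q → P) → (d : Dec P) (e : Dec Q) → does d ≡ does e
  does-cong f g (yes p) (yes q) = refl
  does-cong f g (yes p) (no ¬q) = ⊥-elim (¬q (f p))
  does-cong f g (no ¬p) (yes q) = ⊥-elim (¬p (g q))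
  does-cong f g (no ¬p) (no ¬q) = refl

  -- Extensionality turns equivalent decidable predicates into equal Boolean
  -- functions, so excluded middle picks the same element from both.
  module Representative (S : Setoid 0ℓ 0ℓ) where
    open Setoid S using (Carrier; _≈_) renaming (refl to ≈-refl; sym to ≈-sym; trans to ≈-trans)

    private abstract
      class : Carrier → Carrier → Bool
      class a b = does (em {a ≈ b})

      pick : (f : Carrier → Bool) → (∃[ b ] f b ≡ true) → Carrier
      pick f w with em {∃[ b ] f b ≡ true}
      ... | yes (b , _) = b
      ... | no ¬w       = ⊥-elim (¬w w)

      pick-true : (f : Carrier → Bool) (w : ∃[ b ] f b ≡ true) → f (pick f w) ≡ true
      pick-true f w with em {∃[ b ] f b ≡ true}
      ... | yes (_ , fb) = fb
      ... | no ¬w        = ⊥-elim (¬w w)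

      pick-cong : {f g : Carrier → Bool} → f ≡ g → ∀ v w → pick f v ≡ pick g w
      pick-cong {f} refl v w with em {∃[ b ] f b ≡ true}
      ... | yes _ = refl
      ... | no ¬w = ⊥-elim (¬w w)

      class-self : ∀ a → class a a ≡ true
      class-self a = dec-true em ≈-refl

    abstract
      rep : Carrier → Carrier
      rep a = pick (class a) (a , class-self a)

      rep-≈ : ∀ a → rep a ≈ a
      rep-≈ a = ≈-sym (does-true em (pick-true (class a) (a , class-self a)))

      rep-cong : ∀ {a b} → a ≈ b → rep a ≡ rep b
      rep-cong a≈b = pick-cong
        (ext λ c → does-cong (≈-trans (≈-sym a≈b)) (≈-trans a≈b) em em) _ _

    rep-injective : ∀ {a b} → rep a ≡ rep b → a ≈ b
    rep-injective {a} {b} eq =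
      ≈-trans (≈-sym (rep-≈ a)) (subst (_≈ b) (sym eq) (rep-≈ b))

    Rep : Set
    Rep = Σ[ a ∈ Carrier ] rep a ≡ a

    toRep : Carrier → Rep
    toRep a = rep a , rep-cong (rep-≈ a)

    Rep-≡ : {s t : Rep} → proj₁ s ≈ proj₁ t → s ≡ t
    Rep-≡ {_ , p} {_ , q} a≈b = go (trans (sym p) (trans (rep-cong a≈b) q)) p q
      where
      go : ∀ {a b} → a ≡ b → (p : rep a ≡ a) (q : rep b ≡ b) → (a , p) ≡ (b , q)
      go refl p q = cong (_ ,_) (uip p q)

    toRep-cong : ∀ {a b} → a ≈ b → toRep a ≡ toRep b
    toRep-cong {a} {b} a≈b = Rep-≡ (≈-trans (rep-≈ a) (≈-trans a≈b (≈-sym (rep-≈ b))))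

    toRep-injective : ∀ {a b} → toRep a ≡ toRep b → a ≈ b
    toRep-injective eq = rep-injective (cong proj₁ eq)

    Rep-injection : (T : Setoid 0ℓ 0ℓ) (f : Rep → Setoid.Carrier T) →
                    (∀ {s t} → Setoid._≈_ T (f s) (f t) → s ≡ t) → Injection S T
    Rep-injection T f f-injective = record
      { to        = f ∘ toRep
      ; cong      = λ a≈b → Setoid.reflexive T (cong f (toRep-cong a≈b))
      ; injective = λ eq → toRep-injective (f-injective eq)
      }

  -- Sets coded by reals, and reflection.

  Coded : Set → Set
  Coded X = Σ[ code ∈ (X → 𝒞) ] (∀ {a b} → code a ≡ code b → a ≡ b)

  code : Coded X → X → 𝒞
  code = proj₁

  code-injective : (c : Coded X) → ∀ {a b} → code c a ≡ code c b → a ≡ b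
  code-injective = proj₂

  join : (ℕ → 𝒞) → 𝒞
  join = flatten

  join-injective : ∀ {f g} → join f ≡ join g → f ≡ g
  join-injective {f} {g} eq = ext λ m → ext λ n →
    trans (sym (flatten-pair f m n)) (trans (cong-app eq (pair m n)) (flatten-pair g m n))

  ◂-injective : {a b : X} {s t : ℕ → X} → a ◂ s ≡ b ◂ t → a ≡ b × s ≡ t
  ◂-injective eq = cong-app eq 0 , ext λ n → cong-app eq (suc n)

  coded-𝒞 : Coded 𝒞
  coded-𝒞 = id , id

  coded-Bool : Coded Bool
  coded-Bool = (λ b _ → b) , λ eq → cong-app eq 0

  coded-ℕ : Coded ℕ
  coded-ℕ = (λ n k → does (k ℕ.≟ n)) ,
    λ {m} {n} eq → does-true (m ℕ.≟ n) (trans (sym (cong-app eq m)) (dec-true (m ℕ.≟ m) refl))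

  coded-seq : Coded X → Coded (ℕ → X)
  coded-seq c = (λ f → join (code c ∘ f)) ,
    λ eq → ext λ n → code-injective c (cong-app (join-injective eq) n)

  coded-× : Coded X → Coded Y → Coded (X × Y)
  coded-× c d = (λ (a , b) → join (code c a ◂ λ _ → code d b)) , λ eq →
    let eqs = ◂-injective (join-injective eq) in
    cong₂ _,_ (code-injective c (proj₁ eqs)) (code-injective d (cong-app (proj₂ eqs) 0))

  -- The image of `f` has size at most the continuum; values of `h` off the image are junk.
  SmallImage : (I → J) → Set
  SmallImage {I} {J} f =
    Σ[ h ∈ (J → 𝒞) ] (∀ {i i′} → h (f i) ≡ h (f i′) → f i ≡ f i′)

  -- A node prescribes a type and a countable partial sequence of positions, each
  -- given by a tree and an index.
  data Tree : Set where
    leaf : Tree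
    node : 𝒞 → (ℕ → Bool) → (ℕ → ℕ) → (ℕ → Tree) → Tree

  treeCode : Tree → 𝒞
  treeCode leaf           = λ _ → false
  treeCode (node t b n u) =
    true ◂ join (t ◂ b ◂ code (coded-seq coded-ℕ) n ◂ λ k → treeCode (u k))

  treeCode-injective : ∀ {u v} → treeCode u ≡ treeCode v → u ≡ v
  treeCode-injective {leaf} {leaf} _ = refl
  treeCode-injective {leaf} {node _ _ _ _} eq with () ← cong-app eq 0
  treeCode-injective {node _ _ _ _} {leaf} eq with () ← cong-app eq 0
  treeCode-injective {node t b n u} {node t′ b′ n′ u′} eq
    with refl , eq₁ ← ◂-injective (join-injective (proj₂ (◂-injective eq)))
    with refl , eq₂ ← ◂-injective eq₁
    with eq₃ , eq₄ ← ◂-injective eq₂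
    with refl ← code-injective (coded-seq coded-ℕ) {n} {n′} eq₃
    with refl ← ext {f = u} {g = u′} (λ k → treeCode-injective (cong-app eq₄ k)) = refl

  -- A weak form of the Δ-system lemma: an element i that is not the value of any
  -- tree is reflected to the value j of the tree that describes those positions
  -- of x i which are already occupied by values of trees.
  Δ-system : (f : I → J) → ¬ SmallImage f →
             (x : I → ℕ → E) (type : I → T) → Coded T →
             ∃[ i ] ∃[ j ] (f i ≢ f j × type i ≡ type j ×
                            (∀ m n → x i m ≡ x j n → x i m ≡ x j m))
  Δ-system {I} {J} {E} {T} f large x type c = conclusion
    where
    inhabited : I
    inhabited with em {I}
    ... | yes i = i
    ... | no ¬i = ⊥-elim (large ((λ _ _ → true) , λ {i} → ⊥-elim (¬i i)))

    Reflects : 𝒞 → (ℕ → Bool) → (ℕ → E) → I → Set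
    Reflects t b y j = code c (type j) ≡ t × (∀ m → b m ≡ true → x j m ≡ y m)

    reflect : 𝒞 → (ℕ → Bool) → (ℕ → E) → I
    reflect t b y with em {∃[ j ] Reflects t b y j}
    ... | yes (j , _) = j
    ... | no _        = inhabited

    reflect-correct : ∀ {t b y} → ∃[ j ] Reflects t b y j → Reflects t b y (reflect t b y)
    reflect-correct {t} {b} {y} w with em {∃[ j ] Reflects t b y j}
    ... | yes (_ , r) = r
    ... | no ¬w       = ⊥-elim (¬w w)

    -- The range of `eval` plays the role of a countably closed elementary submodel of size
    -- continuum: a further tree can refer to any countably many positions in its elements, and
    -- `treeCode` bounds the number of trees.
    eval : Tree → I
    eval leaf           = inhabited
    eval (node t b n u) = reflect t b (λ m → x (eval (u m)) (n m))

    missed : ∃[ i ] (∀ u → f (eval u) ≢ f i)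
    missed with em {∃[ i ] (∀ u → f (eval u) ≢ f i)}
    ... | yes w = w
    ... | no ¬w = ⊥-elim (large (h , λ {i} {i′} → h-injective i i′))
      where
      hit : ∀ i → ∃[ u ] f (eval u) ≡ f i
      hit i = decidable-stable em λ ¬hit → ¬w (i , λ u eq → ¬hit (u , eq))

      h : J → 𝒞
      h y with em {∃[ u ] f (eval u) ≡ y}
      ... | yes (u , _) = treeCode u
      ... | no _        = λ _ → true

      h-injective : ∀ i i′ → h (f i) ≡ h (f i′) → f i ≡ f i′
      h-injective i i′ eq with em {∃[ u ] f (eval u) ≡ f i} | em {∃[ u ] f (eval u) ≡ f i′}
      ... | yes (u , p) | yes (u′ , p′) =
        trans (sym p) (trans (cong (f ∘ eval) (treeCode-injective {u} {u′} eq)) p′)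
      ... | no ¬hit | _ = ⊥-elim (¬hit (hit i))
      ... | _ | no ¬hit = ⊥-elim (¬hit (hit i′))

    i : I
    i = proj₁ missed

    Occupied : ℕ → Set
    Occupied m = ∃[ u ] ∃[ n ] x i m ≡ x (eval u) n

    occupant : ∀ m → Dec (Occupied m) → Tree × ℕ
    occupant m (yes (u , n , _)) = u , n
    occupant m (no _)            = leaf , 0

    occupant-correct : ∀ m (d : Dec (Occupied m)) → does d ≡ true →
                       x i m ≡ x (eval (proj₁ (occupant m d))) (proj₂ (occupant m d))
    occupant-correct m (yes (_ , _ , eq)) _ = eq

    tree : Tree
    tree = node (code c (type i)) (λ m → does (em {Occupied m}))
                (λ m → proj₂ (occupant m em)) (λ m → proj₁ (occupant m em))

    j : I
    j = eval tree

    j-reflects : Reflects (code c (type i)) (λ m → does (em {Occupied m}))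
                          (λ m → x (eval (proj₁ (occupant m em))) (proj₂ (occupant m em))) j
    -- The description can be satisfied, because `i` itself fits it.
    j-reflects = reflect-correct (i , refl , λ m → occupant-correct m em)

    conclusion : ∃[ i ] ∃[ j ] (f i ≢ f j × type i ≡ type j ×
                                (∀ m n → x i m ≡ x j n → x i m ≡ x j m))
    conclusion = i , j , (λ eq → proj₂ missed tree (sym eq)) ,
      code-injective c (sym (proj₁ j-reflects)) ,
      -- As `j` is the value of `tree`, the equation `eq` says that `tree` with index `n` occupies
      -- position `m`. So `m` is one of the positions that `tree` prescribes.
      λ m n eq → let occ = dec-true em (tree , n , eq) in
        trans (occupant-correct m em occ) (sym (proj₂ j-reflects m occ))

Eventually : (ℕ → Set) → Set
Eventually Q = ∃[ N ] (∀ i → N ℕ.≤ i → Q i)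

eventually-map : {Q R : ℕ → Set} → (∀ i → Q i → R i) → Eventually Q → Eventually R
eventually-map f (N , h) = N , λ i N≤i → f i (h i N≤i)

eventually-× : {Q R : ℕ → Set} → Eventually Q → Eventually R → Eventually (λ i → Q i × R i)
eventually-× (M , g) (N , h) = M ⊔ N , λ i le →
  g i (ℕ.≤-trans (ℕ.m≤m⊔n M N) le) , h i (ℕ.≤-trans (ℕ.m≤n⊔m M N) le)

-- The poset of conditions, limits and one-step extensions.

module Conditions
  (em₁ : ExcludedMiddle (lsuc 0ℓ)) (ext₁ : Extensionality (lsuc 0ℓ) (lsuc 0ℓ))
  (K Col : Set) (c₀ : Col) (base : ℕ → K) (base-injective : ∀ {i j} → base i ≡ base j → i ≡ j)
  where

  open Classical em₁ ext₁

  Keeps : (K → K → Col) → (ℕ → K) → (ℕ → Col) → K → Set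
  Keeps g s C β = Eventually λ i → ∃[ j ] g (s i) β ≡ C j

  -- A countable partial colouring with countably many promises: all but finitely
  -- many edges from β to the k-th support have an allowed colour.  Every promise allows
  -- c₀, so new edges may be coloured c₀.  Outside Dom the values of colour are junk.
  record Cond : Set where
    field
      point   : ℕ → K
      colour  : K → K → Col
      index   : ℕ → ℕ → ℕ
      allowed : ℕ → ℕ → Col

    Dom : K → Set
    Dom α = ∃[ n ] point n ≡ α

    support : ℕ → ℕ → K
    support k i = point (index k i)

    field
      symmetric : ∀ α β → colour α β ≡ colour β α
      injective : ∀ k {i j} → support k i ≡ support k j → i ≡ j
      default   : ∀ k → allowed k 0 ≡ c₀
      kept      : ∀ k n → Keeps colour (support k) (allowed k) (point n)

  open Cond

  infix 4 _⊑_

  record _⊑_ (p q : Cond) : Set where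
    field
      dom      : ∀ {α} → Dom q α → Dom p α
      coloured : ∀ {α β} → Dom q α → Dom q β → colour p α β ≡ colour q α β
      promise  : ∀ k → ∃[ l ] (support p l ≡ support q k × allowed p l ≡ allowed q k)

  open _⊑_

  ⊑-refl : ∀ {p} → p ⊑ p
  ⊑-refl = record { dom = id ; coloured = λ _ _ → refl ; promise = λ k → k , refl , refl }

  ⊑-trans : ∀ {p q r} → p ⊑ q → q ⊑ r → p ⊑ r
  ⊑-trans pq qr = record
    { dom      = dom pq ∘ dom qr
    ; coloured = λ a b → trans (coloured pq (dom qr a) (dom qr b)) (coloured qr a b)
    ; promise  = λ k → let l , s , c = promise qr k ; m , s′ , c′ = promise pq l in
                       m , trans s′ s , trans c′ c
    }

  -- Mutual extension serves as equality, since one condition has many enumerations and `colour` has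
  -- junk values outside the domain.
  poset : Poset 0ℓ 0ℓ 0ℓ
  poset = record
    { Carrier = Cond
    ; _≈_     = λ p q → p ⊑ q × q ⊑ p
    ; _≤_     = _⊑_
    ; isPartialOrder = record
      { isPreorder = record
        { isEquivalence = record
          { refl  = ⊑-refl , ⊑-refl
          ; sym   = swap
          ; trans = λ (a , b) (c , d) → ⊑-trans a c , ⊑-trans d b
          }
        ; reflexive = proj₁
        ; trans     = ⊑-trans
        }
      ; antisym = _,_
      }
    }

  keeps-dom : ∀ p k {β} → Dom p β → Keeps (colour p) (support p k) (allowed p k) β
  keeps-dom p k (n , refl) = kept p k n

  -- The promise reappears in `p`, whose field `kept` speaks of all points of `p`. Thus promises
  -- bind points that are added later.
  keeps-⊑ : ∀ {p q} → p ⊑ q → ∀ k {β} → Dom p β → Keeps (colour p) (support q k) (allowed q k) β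
  keeps-⊑ {p} p⊑q k {β} β∈p =
    let l , s , c = promise p⊑q k in
    subst₂ (λ s C → Keeps (colour p) s C β) s c (keeps-dom p l β∈p)

  support-dom : ∀ p k i → Dom p (support p k i)
  support-dom p k i = index p k i , refl

  keeps-recolour : ∀ g h s β {C} → (∀ i → h (s i) β ≡ g (s i) β) → Keeps g s C β → Keeps h s C β
  keeps-recolour g h s β eq = eventually-map λ i (j , p) → j , trans (eq i) p

  -- Every `k` carries a promise with an infinite support, so even a starting condition needs an
  -- infinite domain; hence `base`.
  initial : Cond
  initial = record
    { point     = base
    ; colour    = λ _ _ → c₀
    ; index     = λ _ i → i
    ; allowed   = λ _ _ → c₀
    ; symmetric = λ _ _ → refl
    ; injective = λ _ → base-injective
    ; default   = λ _ → refl
    ; kept      = λ _ _ → 0 , λ _ _ → 0 , refl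
    }

  -- Shared by limits and amalgams. The content of a union is that `g` extends all given colourings
  -- and that points of one condition keep the promises of every other.
  module Join
    (P : ℕ → Cond) (g : K → K → Col) (g-symmetric : ∀ α β → g α β ≡ g β α)
    (agrees : ∀ n {α β} → Dom (P n) α → Dom (P n) β → g α β ≡ colour (P n) α β)
    (keeps : ∀ n k m {β} → Dom (P m) β → Keeps g (support (P n) k) (allowed (P n) k) β)
    where

    private
      points : ℕ → K
      points = flatten λ n → point (P n)

      indices : ℕ → ℕ → ℕ
      indices = flatten λ n k i → pair n (index (P n) k i)

      colours : ℕ → ℕ → Col
      colours = flatten λ n → allowed (P n)

      points-pair : ∀ n m → points (pair n m) ≡ point (P n) m
      points-pair = flatten-pair λ n → point (P n)

      supports : ∀ k i → points (indices k i) ≡ flatten (λ n → support (P n)) k i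
      supports k i = points-pair _ (index (P (proj₁ (unpair k))) _ i)

    join-cond : Cond
    join-cond = record
      { point     = points
      ; colour    = g
      ; index     = indices
      ; allowed   = colours
      ; symmetric = g-symmetric
      ; injective = λ k eq → injective (P (proj₁ (unpair k))) (proj₂ (unpair k))
                               (trans (sym (supports k _)) (trans eq (supports k _)))
      ; default   = λ k → default (P (proj₁ (unpair k))) (proj₂ (unpair k))
      ; kept      = λ k m → subst (λ s → Keeps g s (colours k) (points m))
                              (sym (ext (supports k)))
                              (keeps (proj₁ (unpair k)) (proj₂ (unpair k))
                                     (proj₁ (unpair m)) (proj₂ (unpair m) , refl))
      }

    join-⊑ : ∀ n → join-cond ⊑ P n
    join-⊑ n = record
      { dom      = λ (m , eq) → pair n m , trans (points-pair n m) eq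
      ; coloured = agrees n
      ; promise  = λ k → pair n k ,
          trans (ext (supports (pair n k))) (flatten-pair (λ n → support (P n)) n k) ,
          flatten-pair (λ n → allowed (P n)) n k
      }

  module Limit (P : ℕ → Cond) (decreasing : ∀ n → P (suc n) ⊑ P n) where

    antitone : ∀ {m n} → m ℕ.≤ n → P n ⊑ P m
    antitone {m} {n} m≤n = subst (λ n → P n ⊑ P m) (ℕ.m∸n+n≡m m≤n) (go (n ∸ m))
      where
      go : ∀ d → P (d + m) ⊑ P m
      go zero    = ⊑-refl
      go (suc d) = ⊑-trans (decreasing (d + m)) (go d)

    private
      Stage : K → K → Set
      Stage α β = ∃[ n ] (Dom (P n) α × Dom (P n) β)

      colourAt : ∀ α β → Dec (Stage α β) → Col
      colourAt α β (yes (n , _)) = colour (P n) α β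
      colourAt α β (no _)        = c₀

      g : K → K → Col
      g α β = colourAt α β em

      agrees : ∀ n {α β} → Dom (P n) α → Dom (P n) β → g α β ≡ colour (P n) α β
      agrees n {α} {β} a b with em {Stage α β}
      ... | no ¬stage = ⊥-elim (¬stage (n , a , b))
      ... | yes (m , a′ , b′) =
        trans (sym (coloured (antitone (ℕ.m≤m⊔n m n)) a′ b′))
              (coloured (antitone (ℕ.m≤n⊔m m n)) a b)

      g-symmetric : ∀ α β → g α β ≡ g β α
      g-symmetric α β with em {Stage β α}
      ... | yes (n , b , a) = trans (agrees n a b) (symmetric (P n) α β)
      ... | no ¬stage with em {Stage α β}
      ...   | yes (n , a , b) = ⊥-elim (¬stage (n , b , a))
      ...   | no _            = refl

      keeps : ∀ n k m {β} → Dom (P m) β → Keeps g (support (P n) k) (allowed (P n) k) β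
      keeps n k m {β} β∈ = keeps-recolour (colour (P (n ⊔ m))) g (support (P n) k) β
        (λ i → agrees (n ⊔ m) (dom n⊔m⊑n (support-dom (P n) k i)) (dom n⊔m⊑m β∈))
        (keeps-⊑ n⊔m⊑n k (dom n⊔m⊑m β∈))
        where
        n⊔m⊑n = antitone (ℕ.m≤m⊔n n m)
        n⊔m⊑m = antitone (ℕ.m≤n⊔m n m)

    open Join P g g-symmetric agrees keeps public
      renaming (join-cond to limit; join-⊑ to limit-⊑)

  override : (K → Set) → (K → K → Col) → (K → K → Col) → K → K → Col
  override D g e α β with em {D α × D β}
  ... | yes _ = g α β
  ... | no _  = e α β

  override-in : ∀ {D g e α β} → D α → D β → override D g e α β ≡ g α β
  override-in {D} {α = α} {β} a b with em {D α × D β}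
  ... | yes _ = refl
  ... | no ¬d = ⊥-elim (¬d (a , b))

  override-out : ∀ {D g e α β} → ¬ (D α × D β) → override D g e α β ≡ e α β
  override-out {D} {α = α} {β} ¬d with em {D α × D β}
  ... | yes d = ⊥-elim (¬d d)
  ... | no _  = refl

  override-symmetric : ∀ {D g e} → (∀ α β → g α β ≡ g β α) → (∀ α β → e α β ≡ e β α) →
                       ∀ α β → override D g e α β ≡ override D g e β α
  override-symmetric {D} {g} {e} gs es α β with em {D β × D α}
  ... | yes (b , a) = trans (override-in {D} {g} {e} a b) (gs α β)
  ... | no ¬d       = trans (override-out {D} {g} {e} (¬d ∘ swap)) (es α β)

  -- New edges get `c₀`, which every promise allows at index 0. A point already in the domain is
  -- merely enumerated once more.
  module AddPoint (p : Cond) (β : K) where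

    private
      g : K → K → Col
      g = override (Dom p) (colour p) (λ _ _ → c₀)

      keeps : ∀ k γ → Keeps g (support p k) (allowed p k) γ
      keeps k γ with em {Dom p γ}
      ... | yes γ∈ = keeps-recolour (colour p) g (support p k) γ
              (λ i → override-in {Dom p} {colour p} (support-dom p k i) γ∈) (keeps-dom p k γ∈)
      ... | no γ∉  = 0 , λ i _ → 0 ,
        trans (override-out {Dom p} {colour p} (γ∉ ∘ proj₂)) (sym (default p k))

    addPoint : Cond
    addPoint = record
      { point     = β ◂ point p
      ; colour    = g
      ; index     = λ k i → suc (index p k i)
      ; allowed   = allowed p
      ; symmetric = override-symmetric (symmetric p) (λ _ _ → refl)
      ; injective = injective p
      ; default   = default p
      ; kept      = λ k n → keeps k ((β ◂ point p) n)
      }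

    addPoint-⊑ : addPoint ⊑ p
    addPoint-⊑ = record
      { dom      = λ (n , eq) → suc n , eq
      ; coloured = override-in {Dom p} {colour p}
      ; promise  = λ k → k , refl , refl
      }

    addPoint-dom : Dom addPoint β
    addPoint-dom = 0 , refl

  open AddPoint public

  -- All colours between present points are allowed, so these points keep the new promise without
  -- exception; it restricts only points added later.
  module AddPromise (p : Cond) (b : ℕ → ℕ)
                    (b-injective : ∀ {i j} → point p (b i) ≡ point p (b j) → i ≡ j) where

    private
      used : ℕ → Col
      used = flatten λ m n → colour p (point p m) (point p n)

    addPromise : Cond
    addPromise = record
      { point     = point p
      ; colour    = colour p
      ; index     = b ◂ index p
      ; allowed   = (c₀ ◂ used) ◂ allowed p
      ; symmetric = symmetric p
      ; injective = λ { zero → b-injective ; (suc k) → injective p k }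
      ; default   = λ { zero → refl ; (suc k) → default p k }
      -- The successor skips `c₀`, which occupies index 0 for `default`.
      ; kept      = λ { zero n → 0 , λ i _ → suc (pair (b i) n) ,
                          sym (flatten-pair (λ m n → colour p (point p m) (point p n)) (b i) n)
                      ; (suc k) n → kept p k n }
      }

    addPromise-⊑ : addPromise ⊑ p
    addPromise-⊑ = record
      { dom      = id
      ; coloured = λ _ _ → refl
      ; promise  = λ k → suc k , refl , refl
      }

  open AddPromise public

  -- Types and amalgamation.

  Type : Set
  Type = (ℕ → ℕ → Col) × (ℕ → ℕ → Bool) × (ℕ → ℕ → ℕ) × (ℕ → ℕ → Col)

  -- Everything about a condition except the identity of its points. The Boolean matrix records
  -- repetitions in the enumeration.
  type : Cond → Type
  type p = (λ m n → colour p (point p m) (point p n)) ,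
           (λ m n → does (em {point p m ≡ point p n})) , index p , allowed p

  Type-coded : Coded Col → Coded Type
  Type-coded c =
    coded-× (coded-seq (coded-seq c)) (coded-× (coded-seq (coded-seq coded-Bool))
      (coded-× (coded-seq (coded-seq coded-ℕ)) (coded-seq (coded-seq c))))

  record Twins (q s : Cond) : Set where
    field
      sameType : type q ≡ type s
      sharedˡ  : ∀ {m n} → point q m ≡ point s n → point q m ≡ point s m

    sameColour : ∀ m n → colour q (point q m) (point q n) ≡ colour s (point s m) (point s n)
    sameColour m n = cong (λ t → proj₁ t m n) sameType

    sameIndex : ∀ k i → index q k i ≡ index s k i
    sameIndex k i = cong (λ t → proj₁ (proj₂ (proj₂ t)) k i) sameType

    sameAllowed : ∀ k i → allowed q k i ≡ allowed s k i
    sameAllowed k i = cong (λ t → proj₂ (proj₂ (proj₂ t)) k i) sameType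

    samePattern : ∀ {m n} → point s m ≡ point s n → point q m ≡ point q n
    samePattern {m} {n} eq = does-true em
      (trans (cong (λ t → proj₁ (proj₂ t) m n) sameType) (dec-true em eq))

    -- By `sharedˡ` the point `s` repeats at `m` and `n`, and `samePattern` carries the repetition
    -- over to `q`. A common point thus has the same positions in both enumerations.
    sharedʳ : ∀ {m n} → point q m ≡ point s n → point q n ≡ point s n
    sharedʳ eq = trans (samePattern (trans (sym eq) (sharedˡ eq))) eq

  -- Edges between the two domains are coloured by e.  On the common part a promise
  -- of one twin is a promise of the other, which takes care of the edges coloured
  -- by p and by s.
  module Amalgam {q s : Cond} (twins : Twins q s) {p : Cond} (q⊑p : q ⊑ p)
    (e : K → K → Col) (e-symmetric : ∀ α β → e α β ≡ e β α)
    (e-almost : ∀ β → ∃[ α₀ ] (∀ α → α ≢ α₀ → e α β ≡ c₀)) where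

    open Twins twins

    private
      g : K → K → Col
      g = override (Dom p) (colour p) (override (Dom s) (colour s) e)

      g-p : ∀ {α β} → Dom p α → Dom p β → g α β ≡ colour p α β
      g-p = override-in {Dom p} {colour p}

      p⇒q : ∀ {α β} → Dom p α → Dom p β → colour p α β ≡ colour q α β
      p⇒q a b = sym (coloured q⊑p a b)

      p-s : ∀ {α β} → Dom p α → Dom p β → Dom s α → Dom s β → colour p α β ≡ colour s α β
      p-s a b (m , refl) (n , refl) = trans (p⇒q a b) (agree (dom q⊑p a) (dom q⊑p b))
        where
        agree : Dom q (point s m) → Dom q (point s n) →
                colour q (point s m) (point s n) ≡ colour s (point s m) (point s n)
        agree (i , eq) (j , eq′) = trans
          (sym (cong₂ (colour q) (sharedʳ eq) (sharedʳ eq′))) (sameColour m n)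

      g-s : ∀ {α β} → Dom s α → Dom s β → g α β ≡ colour s α β
      g-s {α} {β} a b with em {Dom p α × Dom p β}
      ... | yes (a′ , b′) = p-s a′ b′ a b
      ... | no _          = override-in {Dom s} {colour s} a b

      g-e : ∀ {α β} → ¬ (Dom p α × Dom p β) → ¬ (Dom s α × Dom s β) → g α β ≡ e α β
      g-e ¬p ¬s = trans (override-out {Dom p} {colour p} ¬p) (override-out {Dom s} {colour s} ¬s)

      -- The injective `A` meets the exceptional point of `β` at most once. This is why promises
      -- tolerate finitely many exceptions.
      e-keeps : (A : ℕ → K) → (∀ {i j} → A i ≡ A j → i ≡ j) →
                ∀ β → Eventually λ i → e (A i) β ≡ c₀
      e-keeps A A-injective β with e-almost β
      ... | α₀ , almost with em {∃[ i ] A i ≡ α₀}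
      ...   | yes (i₀ , refl) = suc i₀ , λ i i₀<i →
                almost (A i) λ eq → ℕ.<⇒≢ i₀<i (sym (A-injective eq))
      ...   | no ¬hit = 0 , λ i _ → almost (A i) λ eq → ¬hit (i , eq)

      keeps-pp : ∀ k {β} → Dom p β → Keeps g (support p k) (allowed p k) β
      keeps-pp k {β} β∈p = keeps-recolour (colour p) g (support p k) β
        (λ i → g-p (support-dom p k i) β∈p) (keeps-dom p k β∈p)

      keeps-ss : ∀ k {β} → Dom s β → Keeps g (support s k) (allowed s k) β
      keeps-ss k {β} β∈s = keeps-recolour (colour s) g (support s k) β
        (λ i → g-s (support-dom s k i) β∈s) (keeps-dom s k β∈s)

      keeps-ps : ∀ k {β} → Dom s β → Keeps g (support p k) (allowed p k) β
      keeps-ps k {β} β∈s with em {Dom p β}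
      ... | yes β∈p = keeps-pp k β∈p
      ... | no β∉p with promise q⊑p k
      -- Promise `k` of `p` is promise `l` of `q`. Its counterpart in `s` is again number `l`, and
      -- `β` keeps that one.
      ...   | l , sup , allow = eventually-map step
                (eventually-× (keeps-dom s l β∈s) (e-keeps (support p k) (injective p k) β))
        where
        step : ∀ i →
               (∃[ j ] colour s (support s l i) β ≡ allowed s l j) × e (support p k i) β ≡ c₀ →
               ∃[ j ] g (support p k i) β ≡ allowed p k j
        step i ((j , good) , cross) with em {Dom s (support p k i)}
        ... | no A∉s = 0 , trans (g-e (β∉p ∘ proj₂) (A∉s ∘ proj₁)) (trans cross (sym (default p k)))
        ... | yes A∈s@(n , eq) = j , trans (g-s A∈s β∈s)
                (trans (cong (λ α → colour s α β) A≡)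
                (trans good (trans (sym (sameAllowed l j)) (cong-app allow j))))
          where
          A≡ : support p k i ≡ support s l i
          A≡ = trans (sym (cong-app sup i))
                 (trans (sharedˡ (trans (cong-app sup i) (sym eq)))
                        (cong (point s) (sameIndex l i)))

      keeps-sp : ∀ k {β} → Dom p β → Keeps g (support s k) (allowed s k) β
      keeps-sp k {β} β∈p with em {Dom s β}
      ... | yes β∈s = keeps-ss k β∈s
      ... | no β∉s = eventually-map step
              (eventually-× (keeps-dom q k (dom q⊑p β∈p)) (e-keeps (support s k) (injective s k) β))
        where
        step : ∀ i →
               (∃[ j ] colour q (support q k i) β ≡ allowed q k j) × e (support s k i) β ≡ c₀ →
               ∃[ j ] g (support s k i) β ≡ allowed s k j
        step i ((j , good) , cross) with em {Dom p (support s k i)}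
        ... | no A∉p = 0 , trans (g-e (A∉p ∘ proj₁) (β∉s ∘ proj₂)) (trans cross (sym (default s k)))
        ... | yes A∈p = j , trans (g-p A∈p β∈p) (trans (p⇒q A∈p β∈p)
                (trans (cong (λ α → colour q α β) A≡) (trans good (sameAllowed k j))))
          where
          A≡ : support s k i ≡ support q k i
          A≡ = trans (sym (sharedʳ (proj₂ (dom q⊑p A∈p)))) (cong (point q) (sym (sameIndex k i)))

      P : ℕ → Cond
      P = p ◂ λ _ → s

      agrees : ∀ n {α β} → Dom (P n) α → Dom (P n) β → g α β ≡ colour (P n) α β
      agrees zero    = g-p
      agrees (suc _) = g-s

      keeps : ∀ n k m {β} → Dom (P m) β → Keeps g (support (P n) k) (allowed (P n) k) β
      keeps zero    k zero    β∈ = keeps-pp k β∈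
      keeps zero    k (suc _) β∈ = keeps-ps k β∈
      keeps (suc _) k zero    β∈ = keeps-sp k β∈
      keeps (suc _) k (suc _) β∈ = keeps-ss k β∈

      open Join P g
        (override-symmetric (symmetric p) (override-symmetric (symmetric s) e-symmetric))
        agrees keeps

    amalgamate : ∃[ u ] (u ⊑ p × u ⊑ s ×
                         (∀ {α β} → ¬ Dom p α → ¬ Dom s β → colour u α β ≡ e α β))
    amalgamate = join-cond , join-⊑ 0 , join-⊑ 1 , λ α∉p β∉s → g-e (α∉p ∘ proj₁) (β∉s ∘ proj₂)

  open Amalgam public

-- The forcing relation as a classical deduction system.

module ForcingLogic (em₁ : ExcludedMiddle (lsuc 0ℓ)) (P : Poset 0ℓ 0ℓ 0ℓ) where

  open Poset P using (_≤_) renaming (Carrier to Condition; refl to ≤-refl; trans to ≤-trans)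
  open Forcing P

  private variable
    p q r : Condition
    σ τ ρ x y z x′ y′ a b f u v w : Name
    φ ψ χ : Formula Name
    Φ : Name → Formula Name

  ∈̇-mono : ∀ σ τ → q ≤ p → p ⊩ σ ∈̇ τ → q ⊩ σ ∈̇ τ
  ∈̇-mono σ (name J τ t) q≤p h r r≤q = h r (≤-trans r≤q q≤p)

  ≐̇-mono : ∀ σ τ → q ≤ p → p ⊩ σ ≐̇ τ → q ⊩ σ ≐̇ τ
  ≐̇-mono (name I σ s) (name J τ t) q≤p (f , g) =
    (λ i r r≤q → f i r (≤-trans r≤q q≤p)) , (λ j r r≤q → g j r (≤-trans r≤q q≤p))

  ⊩-mono : ∀ φ → q ≤ p → p ⊩ φ → q ⊩ φ
  ⊩-mono (σ ∈ τ) q≤p (lift h) = lift (∈̇-mono σ τ q≤p h)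
  ⊩-mono (σ ≐ τ) q≤p (lift h) = lift (≐̇-mono σ τ q≤p h)
  ⊩-mono (¬′ φ)  q≤p h        = λ r r≤q → h r (≤-trans r≤q q≤p)
  ⊩-mono (φ ∧ ψ) q≤p (h , k)  = ⊩-mono φ q≤p h , ⊩-mono ψ q≤p k
  ⊩-mono (all φ) q≤p h        = λ σ → ⊩-mono (φ σ) q≤p (h σ)

  ∈̇-dense : ∀ σ τ → (∀ q → q ≤ p → ∃[ r ] (r ≤ q × (r ⊩ σ ∈̇ τ))) → p ⊩ σ ∈̇ τ
  ∈̇-dense σ (name J τ t) h q q≤p =
    let r , r≤q , k = h q q≤p ; r′ , r′≤r , w = k r ≤-refl in r′ , ≤-trans r′≤r r≤q , w

  ≐̇-dense : ∀ σ τ → (∀ q → q ≤ p → ∃[ r ] (r ≤ q × (r ⊩ σ ≐̇ τ))) → p ⊩ σ ≐̇ τ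
  ≐̇-dense {p} σ@(name I σ′ s) τ@(name J τ′ t) h =
    (λ i q q≤p q≤s → ∈̇-dense (σ′ i) τ λ q′ q′≤q →
      let r , r≤q′ , f , _ = h q′ (≤-trans q′≤q q≤p)
      in r , r≤q′ , f i r ≤-refl (≤-trans r≤q′ (≤-trans q′≤q q≤s))) ,
    (λ j q q≤p q≤t → ∈̇-dense (τ′ j) σ λ q′ q′≤q →
      let r , r≤q′ , _ , g = h q′ (≤-trans q′≤q q≤p)
      in r , r≤q′ , g j r ≤-refl (≤-trans r≤q′ (≤-trans q′≤q q≤t)))

  -- Atoms have density built into the clause for membership, and negation follows by monotonicity.
  -- Classical reasoning under forcing rests on this.
  ⊩-dense : ∀ φ → (∀ q → q ≤ p → ∃[ r ] (r ≤ q × (r ⊩ φ))) → p ⊩ φ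
  ⊩-dense (σ ∈ τ) h = lift (∈̇-dense σ τ λ q q≤p → let r , r≤q , k = h q q≤p in r , r≤q , lower k)
  ⊩-dense (σ ≐ τ) h = lift (≐̇-dense σ τ λ q q≤p → let r , r≤q , k = h q q≤p in r , r≤q , lower k)
  ⊩-dense (¬′ φ)  h = λ q q≤p k →
    let r , r≤q , ¬k = h q q≤p in ¬k r ≤-refl (⊩-mono φ r≤q k)
  ⊩-dense (φ ∧ ψ) h =
    ⊩-dense φ (λ q q≤p → let r , r≤q , k , _ = h q q≤p in r , r≤q , k) ,
    ⊩-dense ψ (λ q q≤p → let r , r≤q , _ , k = h q q≤p in r , r≤q , k)
  ⊩-dense (all φ) h = λ σ → ⊩-dense (φ σ) λ q q≤p → let r , r≤q , k = h q q≤p in r , r≤q , k σ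

  ≐̇-refl : ∀ σ → p ⊩ σ ≐̇ σ
  ≐̇-refl (name I σ s) =
    (λ i q _ q≤s r r≤q → r , ≤-refl , i , ≤-trans r≤q q≤s , ≐̇-refl (σ i)) ,
    (λ i q _ q≤s r r≤q → r , ≤-refl , i , ≤-trans r≤q q≤s , ≐̇-refl (σ i))

  ≐̇-sym : ∀ σ τ → p ⊩ σ ≐̇ τ → p ⊩ τ ≐̇ σ
  ≐̇-sym (name _ _ _) (name _ _ _) = swap

  ≐̇-trans : ∀ ρ σ τ → p ⊩ ρ ≐̇ σ → p ⊩ σ ≐̇ τ → p ⊩ ρ ≐̇ τ
  ≐̇-trans (name I ρ s) (name J σ t) (name K τ u) (ρ⊆σ , σ⊆ρ) (σ⊆τ , τ⊆σ) =
    (λ i q q≤p q≤s q′ q′≤q →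
      let r , r≤q′ , j , r≤t , ρ≐σ = ρ⊆σ i q q≤p q≤s q′ q′≤q
          r′ , r′≤r , k , r′≤u , σ≐τ =
            σ⊆τ j r (≤-trans r≤q′ (≤-trans q′≤q q≤p)) r≤t r ≤-refl
      in r′ , ≤-trans r′≤r r≤q′ , k , r′≤u ,
         ≐̇-trans (ρ i) (σ j) (τ k) (≐̇-mono (ρ i) (σ j) r′≤r ρ≐σ) σ≐τ) ,
    (λ k q q≤p q≤u q′ q′≤q →
      let r , r≤q′ , j , r≤t , τ≐σ = τ⊆σ k q q≤p q≤u q′ q′≤q
          r′ , r′≤r , i , r′≤s , σ≐ρ =
            σ⊆ρ j r (≤-trans r≤q′ (≤-trans q′≤q q≤p)) r≤t r ≤-refl
      in r′ , ≤-trans r′≤r r≤q′ , i , r′≤s ,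
         ≐̇-trans (τ k) (σ j) (ρ i) (≐̇-mono (τ k) (σ j) r′≤r τ≐σ) σ≐ρ)

  infix 1 _⊢_

  -- A wrapper around _⊩_ from which Agda can infer the formula.
  record _⊢_ (p : Condition) (φ : Formula Name) : Set₁ where
    constructor ⟪_⟫
    field forced : p ⊩ φ
  open _⊢_ public

  infixl 9 _↓_
  _↓_ : p ⊢ φ → q ≤ p → q ⊢ φ
  _↓_ {φ = φ} ⟪ h ⟫ q≤p = ⟪ ⊩-mono φ q≤p h ⟫

  dense : (∀ {q} → q ≤ p → ∃[ r ] (r ≤ q × (r ⊢ φ))) → p ⊢ φ
  dense {φ = φ} h = ⟪ ⊩-dense φ (λ q q≤p → let r , r≤q , ⟪ k ⟫ = h q≤p in r , r≤q , k) ⟫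

  -- If no `q` below `p` forces the negation, conditions forcing `φ` are dense below `p`. The
  -- eliminations of disjunction, implication and existence all go through this rule, these being
  -- defined by negation.
  contradict : (∀ {q} → q ≤ p → ¬ (q ⊢ ¬′ φ)) → p ⊢ φ
  contradict {φ = φ} h = dense λ {q} q≤p → decidable-stable em₁ λ ¬w →
    h q≤p ⟪ (λ r r≤q k → ¬w (r , r≤q , ⟪ k ⟫)) ⟫

  ¬I : (∀ {q} → q ≤ p → ¬ (q ⊢ φ)) → p ⊢ ¬′ φ
  ¬I h = ⟪ (λ q q≤p k → h q≤p ⟪ k ⟫) ⟫

  ¬E : p ⊢ ¬′ φ → ¬ (p ⊢ φ)
  ¬E ⟪ h ⟫ ⟪ k ⟫ = h _ ≤-refl k

  ∧I : p ⊢ φ → p ⊢ ψ → p ⊢ φ ∧ ψ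
  ∧I ⟪ h ⟫ ⟪ k ⟫ = ⟪ (h , k) ⟫

  ∧E₁ : p ⊢ φ ∧ ψ → p ⊢ φ
  ∧E₁ ⟪ h ⟫ = ⟪ proj₁ h ⟫

  ∧E₂ : p ⊢ φ ∧ ψ → p ⊢ ψ
  ∧E₂ ⟪ h ⟫ = ⟪ proj₂ h ⟫

  ⇒I : (∀ {q} → q ≤ p → q ⊢ φ → q ⊢ ψ) → p ⊢ φ ⇒ ψ
  ⇒I h = ¬I λ q≤p k → ¬E (∧E₂ k) (h q≤p (∧E₁ k))

  ⇒E : p ⊢ φ ⇒ ψ → p ⊢ φ → p ⊢ ψ
  ⇒E h k = contradict λ q≤p ¬ψ → ¬E (h ↓ q≤p) (∧I (k ↓ q≤p) ¬ψ)

  ⇔I : (∀ {q} → q ≤ p → q ⊢ φ → q ⊢ ψ) → (∀ {q} → q ≤ p → q ⊢ ψ → q ⊢ φ) → p ⊢ φ ⇔ ψ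
  ⇔I h k = ∧I (⇒I h) (⇒I k)

  ∨I₁ : p ⊢ φ → p ⊢ φ ∨ ψ
  ∨I₁ h = ¬I λ q≤p k → ¬E (∧E₁ k) (h ↓ q≤p)

  ∨I₂ : p ⊢ ψ → p ⊢ φ ∨ ψ
  ∨I₂ h = ¬I λ q≤p k → ¬E (∧E₂ k) (h ↓ q≤p)

  ∨E : p ⊢ φ ∨ ψ → (∀ {q} → q ≤ p → q ⊢ φ → q ⊢ χ) → (∀ {q} → q ≤ p → q ⊢ ψ → q ⊢ χ) → p ⊢ χ
  ∨E h f g = contradict λ q≤p ¬χ → ¬E (h ↓ q≤p)
    (∧I (¬I λ r≤q k → ¬E (¬χ ↓ r≤q) (f (≤-trans r≤q q≤p) k))
        (¬I λ r≤q k → ¬E (¬χ ↓ r≤q) (g (≤-trans r≤q q≤p) k)))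

  allI : (∀ σ → p ⊢ Φ σ) → p ⊢ all Φ
  allI h = ⟪ (λ σ → forced (h σ)) ⟫

  allE : p ⊢ all Φ → ∀ σ → p ⊢ Φ σ
  allE ⟪ h ⟫ σ = ⟪ h σ ⟫

  exI : ∀ σ → p ⊢ Φ σ → p ⊢ ex Φ
  exI σ h = ¬I λ q≤p k → ¬E (allE k σ) (h ↓ q≤p)

  exE : p ⊢ ex Φ → (∀ {q} → q ≤ p → ∀ σ → q ⊢ Φ σ → q ⊢ χ) → p ⊢ χ
  exE h f = contradict λ q≤p ¬χ → ¬E (h ↓ q≤p)
    (allI λ σ → ¬I λ r≤q k → ¬E (¬χ ↓ r≤q) (f (≤-trans r≤q q≤p) σ k))

  -- Different extensions of `p` may have different witnesses, so a single name is reached by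
  -- strengthening `p`.
  exE∃ : p ⊢ ex Φ → ∃[ q ] (q ≤ p × ∃[ σ ] (q ⊢ Φ σ))
  exE∃ h = decidable-stable em₁ λ ¬w →
    ¬E h (allI λ σ → ¬I λ q≤p k → ¬w (_ , q≤p , σ , k))

  allInI : (∀ {q} → q ≤ p → ∀ σ → q ⊢ σ ∈ a → q ⊢ Φ σ) → p ⊢ allIn a Φ
  allInI h = allI λ σ → ⇒I λ q≤p → h q≤p σ

  allInE : p ⊢ allIn a Φ → p ⊢ σ ∈ a → p ⊢ Φ σ
  allInE h = ⇒E (allE h _)

  exInI : ∀ σ → p ⊢ σ ∈ a → p ⊢ Φ σ → p ⊢ exIn a Φ
  exInI σ h k = exI σ (∧I h k)

  exInE : p ⊢ exIn a Φ → (∀ {q} → q ≤ p → ∀ σ → q ⊢ σ ∈ a → q ⊢ Φ σ → q ⊢ χ) → p ⊢ χ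
  exInE h f = exE h λ q≤p σ k → f q≤p σ (∧E₁ k) (∧E₂ k)

  ≐-refl : p ⊢ σ ≐ σ
  ≐-refl {σ = σ} = ⟪ lift (≐̇-refl σ) ⟫

  ≐-reflexive : σ ≡ τ → p ⊢ σ ≐ τ
  ≐-reflexive refl = ≐-refl

  ≐-sym : p ⊢ σ ≐ τ → p ⊢ τ ≐ σ
  ≐-sym {σ = σ} {τ} ⟪ lift h ⟫ = ⟪ lift (≐̇-sym σ τ h) ⟫

  ≐-trans : p ⊢ ρ ≐ σ → p ⊢ σ ≐ τ → p ⊢ ρ ≐ τ
  ≐-trans {ρ = ρ} {σ} {τ} ⟪ lift h ⟫ ⟪ lift k ⟫ = ⟪ lift (≐̇-trans ρ σ τ h k) ⟫

  module _ {J : Set} {τ : J → Name} {t : J → Condition} where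

    ∈I : ∀ j → p ≤ t j → p ⊢ σ ≐ τ j → p ⊢ σ ∈ name J τ t
    ∈I {σ = σ} j p≤t ⟪ lift h ⟫ = ⟪ lift (λ q q≤p →
      q , ≤-refl , j , ≤-trans q≤p p≤t , ≐̇-mono σ (τ j) q≤p h) ⟫

    ∈E∃ : p ⊢ σ ∈ name J τ t → ∃[ q ] (q ≤ p × ∃[ j ] (q ≤ t j × (q ⊢ σ ≐ τ j)))
    ∈E∃ ⟪ lift h ⟫ =
      let q , q≤p , j , q≤t , k = h _ ≤-refl in q , q≤p , j , q≤t , ⟪ lift k ⟫

    ∈E : p ⊢ σ ∈ name J τ t → (∀ {q} → q ≤ p → ∀ j → q ≤ t j → q ⊢ σ ≐ τ j → q ⊢ χ) → p ⊢ χ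
    ∈E h f = dense λ q≤p →
      let r , r≤q , j , r≤t , k = ∈E∃ (h ↓ q≤p) in r , r≤q , f (≤-trans r≤q q≤p) j r≤t k

  ∈-congˡ : p ⊢ σ ≐ τ → p ⊢ σ ∈ a → p ⊢ τ ∈ a
  ∈-congˡ {a = name _ _ _} eq h =
    ∈E h λ q≤p j q≤t k → ∈I j q≤t (≐-trans (≐-sym (eq ↓ q≤p)) k)

  ∈-congʳ : p ⊢ a ≐ b → p ⊢ σ ∈ a → p ⊢ σ ∈ b
  ∈-congʳ {a = name I a s} {name J b t} ⟪ lift (a⊆b , _) ⟫ h = ∈E h λ q≤p i q≤s k →
    ∈-congˡ (≐-sym k) ⟪ lift (a⊆b i _ q≤p q≤s) ⟫

  ≐-ext : (∀ {q} → q ≤ p → ∀ ρ → q ⊢ ρ ∈ a → q ⊢ ρ ∈ b) →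
          (∀ {q} → q ≤ p → ∀ ρ → q ⊢ ρ ∈ b → q ⊢ ρ ∈ a) → p ⊢ a ≐ b
  ≐-ext {a = name I a s} {name J b t} f g = ⟪ lift
    ( (λ i q q≤p q≤s → lower (forced (f q≤p (a i) (∈I i q≤s ≐-refl))))
    , (λ j q q≤p q≤t → lower (forced (g q≤p (b j) (∈I j q≤t ≐-refl)))) ) ⟫

  falsum : Formula Name
  falsum = all λ z → ¬′ z ≐ z

  ¬falsum : ¬ (p ⊢ falsum)
  ¬falsum h = ¬E (allE h (name ⊥ ⊥-elim ⊥-elim)) ≐-refl

  -- Eliminators for ⊢ yield only forced formulas; extract turns them on a classical
  -- statement G.
  extract₁ : {G : Set₁} → (¬ G → p ⊢ falsum) → G
  extract₁ h = decidable-stable em₁ λ ¬g → ¬falsum (h ¬g)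

  extract : {G : Set} → (¬ G → p ⊢ falsum) → G
  extract h = lower (extract₁ λ ¬g → h (¬g ∘ lift))

  -- Names for pairs and functions.

  upair : Name → Name → Name
  upair σ τ = name (Bool × Condition) (λ (b , _) → if b then σ else τ) proj₂

  ∈-upairˡ : p ⊢ ρ ≐ σ → p ⊢ ρ ∈ upair σ τ
  ∈-upairˡ = ∈I (true , _) ≤-refl

  ∈-upairʳ : p ⊢ ρ ≐ τ → p ⊢ ρ ∈ upair σ τ
  ∈-upairʳ = ∈I (false , _) ≤-refl

  ∈-upairE : p ⊢ ρ ∈ upair σ τ → p ⊢ ρ ≐ σ ∨ ρ ≐ τ
  ∈-upairE h = ∈E h λ { _ (true , _) _ eq → ∨I₁ eq ; _ (false , _) _ eq → ∨I₂ eq }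

  ∨-∈-upair : p ⊢ ρ ≐ σ ∨ ρ ≐ τ → p ⊢ ρ ∈ upair σ τ
  ∨-∈-upair h = ∨E h (λ _ → ∈-upairˡ) (λ _ → ∈-upairʳ)

  ≐upair⇒≐❴❵ : p ⊢ z ≐ upair x y → p ⊢ z ≐❴ x , y ❵
  ≐upair⇒≐❴❵ eq = allI λ _ → ⇔I
    (λ q≤p h → ∈-upairE (∈-congʳ (eq ↓ q≤p) h))
    (λ q≤p h → ∈-congʳ (≐-sym (eq ↓ q≤p)) (∨-∈-upair h))

  ≐❴❵⇒≐upair : p ⊢ z ≐❴ x , y ❵ → p ⊢ z ≐ upair x y
  ≐❴❵⇒≐upair h = ≐-ext
    (λ q≤p ρ k → ∨-∈-upair (⇒E (∧E₁ (allE h ρ ↓ q≤p)) k))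
    (λ q≤p ρ k → ⇒E (∧E₂ (allE h ρ ↓ q≤p)) (∈-upairE k))

  upair-⊆ : p ⊢ x ≐ x′ → p ⊢ y ≐ y′ → p ⊢ ρ ∈ upair x y → p ⊢ ρ ∈ upair x′ y′
  upair-⊆ ex ey h = ∨E (∈-upairE h)
    (λ q≤p k → ∈-upairˡ (≐-trans k (ex ↓ q≤p))) (λ q≤p k → ∈-upairʳ (≐-trans k (ey ↓ q≤p)))

  upair-cong : p ⊢ x ≐ x′ → p ⊢ y ≐ y′ → p ⊢ upair x y ≐ upair x′ y′
  upair-cong ex ey = ≐-ext
    (λ q≤p _ → upair-⊆ (ex ↓ q≤p) (ey ↓ q≤p))
    (λ q≤p _ → upair-⊆ (≐-sym ex ↓ q≤p) (≐-sym ey ↓ q≤p))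

  upair-comm : p ⊢ upair x y ≐ upair y x
  upair-comm = ≐-ext (λ _ _ → swapped) (λ _ _ → swapped)
    where
    swapped : q ⊢ ρ ∈ upair x y → q ⊢ ρ ∈ upair y x
    swapped h = ∨E (∈-upairE h) (λ _ → ∈-upairʳ) (λ _ → ∈-upairˡ)

  singleton-injective : p ⊢ upair x x ≐ upair y z → p ⊢ x ≐ y
  singleton-injective eq =
    ∨E (∈-upairE (∈-congʳ (≐-sym eq) (∈-upairˡ ≐-refl))) (λ _ → ≐-sym) (λ _ → ≐-sym)

  upair-injectiveʳ : p ⊢ x ≐ x′ → p ⊢ upair x y ≐ upair x′ y′ → p ⊢ y ≐ y′
  upair-injectiveʳ ex eq = ∨E (∈-upairE (∈-congʳ eq (∈-upairʳ ≐-refl)))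
    (λ q≤p y≐x′ → ∨E (∈-upairE (∈-congʳ (≐-sym eq ↓ q≤p) (∈-upairʳ ≐-refl)))
      (λ r≤q y′≐x → ≐-trans (y≐x′ ↓ r≤q) (≐-sym (≐-trans y′≐x (ex ↓ q≤p ↓ r≤q))))
      (λ _ → ≐-sym))
    (λ _ → id)

  opair : Name → Name → Name
  opair x y = upair (upair x x) (upair x y)

  opair-cong : p ⊢ x ≐ x′ → p ⊢ y ≐ y′ → p ⊢ opair x y ≐ opair x′ y′
  opair-cong ex ey = upair-cong (upair-cong ex ex) (upair-cong ex ey)

  opair-injectiveˡ : p ⊢ opair x y ≐ opair x′ y′ → p ⊢ x ≐ x′
  opair-injectiveˡ eq = ∨E (∈-upairE (∈-congʳ eq (∈-upairˡ ≐-refl)))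
    (λ _ → singleton-injective) (λ _ → singleton-injective)

  opair-injectiveʳ : p ⊢ opair x y ≐ opair x′ y′ → p ⊢ y ≐ y′
  opair-injectiveʳ eq =
    let ex = opair-injectiveˡ eq in upair-injectiveʳ ex (upair-injectiveʳ (upair-cong ex ex) eq)

  ≐opair⇒≐⟨⟩ : p ⊢ z ≐ opair x y → p ⊢ z ≐⟨ x , y ⟩
  ≐opair⇒≐⟨⟩ {x = x} {y} eq = exI (upair x x) (exI (upair x y)
    (∧I (≐upair⇒≐❴❵ ≐-refl) (∧I (≐upair⇒≐❴❵ ≐-refl) (≐upair⇒≐❴❵ eq))))

  ≐⟨⟩⇒≐opair : p ⊢ z ≐⟨ x , y ⟩ → p ⊢ z ≐ opair x y
  ≐⟨⟩⇒≐opair h = exE h λ _ u h → exE h λ _ v h →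
    ≐-trans (≐❴❵⇒≐upair (∧E₂ (∧E₂ h)))
            (upair-cong (≐❴❵⇒≐upair (∧E₁ h)) (≐❴❵⇒≐upair (∧E₁ (∧E₂ h))))

  mapsI : p ⊢ opair x y ∈ f → p ⊢ Maps f x y
  mapsI h = exInI _ h (≐opair⇒≐⟨⟩ ≐-refl)

  mapsE : p ⊢ Maps f x y → p ⊢ opair x y ∈ f
  mapsE h = exInE h λ _ _ h eq → ∈-congˡ (≐⟨⟩⇒≐opair eq) h

  maps-cong : p ⊢ x ≐ x′ → p ⊢ y ≐ y′ → p ⊢ Maps f x y → p ⊢ Maps f x′ y′
  maps-cong ex ey h = mapsI (∈-congˡ (opair-cong ex ey) (mapsE h))

  module _ (isFunction : p ⊢ IsFunction f a b) where

    function-components : p ⊢ Maps f x y → p ⊢ x ∈ a ∧ y ∈ b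
    function-components h =
      exInE (allInE (∧E₁ isFunction) (mapsE h)) λ _ x′ x′∈a h →
      exInE h λ r≤q y′ y′∈b eq → let eq′ = ≐⟨⟩⇒≐opair eq in
      ∧I (∈-congˡ (≐-sym (opair-injectiveˡ eq′)) (x′∈a ↓ r≤q))
         (∈-congˡ (≐-sym (opair-injectiveʳ eq′)) y′∈b)

    function-total : p ⊢ x ∈ a → (∀ {q} → q ≤ p → ∀ y → q ⊢ y ∈ b → q ⊢ Maps f x y → q ⊢ χ) → p ⊢ χ
    function-total h k = exInE (allInE (∧E₂ isFunction) h) λ q≤p y y∈b m → k q≤p y y∈b (∧E₁ m)

    function-unique : p ⊢ Maps f x y → p ⊢ Maps f x y′ → p ⊢ y ≐ y′
    function-unique {x = x} h h′ =
      exInE (allInE (∧E₂ isFunction) (∧E₁ (function-components h))) λ {q} q≤p v _ m →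
      let value : ∀ {w} → p ⊢ Maps f x w → q ⊢ w ≐ v
          value k = ⇒E (allInE (∧E₂ m) (∧E₂ (function-components k) ↓ q≤p)) (k ↓ q≤p) in
      ≐-trans (value h) (≐-sym (value h′))

  injective-unique : p ⊢ IsInjective f → p ⊢ Maps f x y → p ⊢ Maps f x′ y → p ⊢ x ≐ x′
  injective-unique {x = x} {y} {x′} h m m′ = ⇒E (allE (allE (allE h x) x′) y) (∧I m m′)

  -- The infinite disjunction σ ≐ s i over i, as an elimination rule.
  Enumerates : {I : Set} → Condition → Name → (I → Name) → Set₁
  Enumerates {I} p a s = ∀ {q} → q ≤ p → ∀ {σ χ} → q ⊢ σ ∈ a →
                         (∀ {r} → r ≤ q → ∀ i → r ⊢ σ ≐ s i → r ⊢ χ) → q ⊢ χ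

  Discrete : {I : Set} → (I → Name) → Set₁
  Discrete s = ∀ {p i j} → p ⊢ s i ≐ s j → i ≡ j

  module Graph {I J : Set} (a : Name) (s : I → Name) (t : J → Name) (h : I → J) where

    -- While `h` lives in the ground model, `a` is an arbitrary name; so a pair is tagged by the
    -- conditions that force its first component into `a`.
    graph : Name
    graph = name (Σ[ i ∈ I ] Σ[ c ∈ Condition ] (c ⊩ s i ∈̇ a))
                 (λ (i , _) → opair (s i) (t (h i))) (λ (_ , c , _) → c)

    graphI : ∀ i → p ⊢ s i ∈ a → p ⊢ Maps graph (s i) (t (h i))
    graphI i ⟪ lift k ⟫ = mapsI (∈I (i , _ , k) ≤-refl ≐-refl)

    graphE : p ⊢ Maps graph x y →
             (∀ {q} → q ≤ p → ∀ i → q ⊢ s i ∈ a → q ⊢ x ≐ s i → q ⊢ y ≐ t (h i) → q ⊢ χ) → p ⊢ χ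
    graphE m k = ∈E (mapsE m) λ { q≤p (i , c , c⊩) q≤c eq →
      k q≤p i (⟪ lift c⊩ ⟫ ↓ q≤c) (opair-injectiveˡ eq) (opair-injectiveʳ eq) }

    module _ (s-enumerates : Enumerates p a s) where

      graph-function : Discrete s → (∀ {q} → q ≤ p → ∀ i → q ⊢ s i ∈ a → q ⊢ t (h i) ∈ b) →
                       p ⊢ IsFunction graph a b
      graph-function s-discrete into = ∧I
        (allInI λ q≤p z z∈ → ∈E z∈ λ { r≤q (i , c , c⊩) r≤c eq →
          let s∈a = ⟪ lift c⊩ ⟫ ↓ r≤c in
          exInI (s i) s∈a (exInI (t (h i)) (into (≤-trans r≤q q≤p) i s∈a) (≐opair⇒≐⟨⟩ eq)) })
        (allInI λ q≤p x x∈a → s-enumerates q≤p x∈a λ r≤q i x≐ →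
          let s∈a = ∈-congˡ x≐ (x∈a ↓ r≤q) in
          exInI (t (h i)) (into (≤-trans r≤q q≤p) i s∈a)
            (∧I (maps-cong (≐-sym x≐) ≐-refl (graphI i s∈a))
                (allInI λ r′≤r y′ _ → ⇒I λ r″≤r′ m → graphE m λ le j _ x≐′ y′≐ →
                  subst (λ j → _ ⊢ y′ ≐ t (h j))
                    (s-discrete (≐-trans (≐-sym x≐′) (x≐ ↓ ≤-trans le (≤-trans r″≤r′ r′≤r)))) y′≐)))

      graph-injective : Discrete t →
        (∀ {q} → q ≤ p → ∀ {i j} → q ⊢ s i ∈ a → q ⊢ s j ∈ a → h i ≡ h j → i ≡ j) →
        p ⊢ IsInjective graph
      graph-injective t-discrete h-injective =
        allI λ x → allI λ x′ → allI λ y → ⇒I λ q≤p m →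
        graphE (∧E₁ m) λ r≤q i i∈ x≐ y≐ → graphE (∧E₂ m ↓ r≤q) λ r′≤r j j∈ x′≐ y≐′ →
        ≐-trans (x≐ ↓ r′≤r)
          (subst (λ j → _ ⊢ s j ≐ x′)
            (sym (h-injective (≤-trans r′≤r (≤-trans r≤q q≤p)) (i∈ ↓ r′≤r) j∈
                   (t-discrete (≐-trans (≐-sym y≐ ↓ r′≤r) y≐′))))
            (≐-sym x′≐))

  injects : {I J : Set} {s : I → Name} {t : J → Name} (h : I → J) →
            Enumerates p a s → Discrete s → Discrete t →
            (∀ {q} → q ≤ p → ∀ i → q ⊢ s i ∈ a → q ⊢ t (h i) ∈ b) →
            (∀ {q} → q ≤ p → ∀ {i j} → q ⊢ s i ∈ a → q ⊢ s j ∈ a → h i ≡ h j → i ≡ j) →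
            p ⊢ InjectsInto a b
  injects {a = a} {s = s} {t} h s-enumerates s-discrete t-discrete into h-injective =
    exI graph (∧I (graph-function s-enumerates s-discrete into)
                  (graph-injective s-enumerates t-discrete h-injective))
    where open Graph a s t h

  -- Canonical names of ordinals.

  module _ (W : WellOrder) where
    open WellOrder W using (Carrier; _<_; <-wellFounded)
    open StrictTotalOrder (WellOrder.strictTotalOrder W) using (_≈_; compare)
      renaming (<-respʳ-≈ to <-respʳ; module Eq to ≈)

    element : Carrier → Name
    element c = elementName W c (<-wellFounded c)

    private
      elementName-cong : ∀ {c d} → c ≈ d → (k : Acc _<_ c) (l : Acc _<_ d) →
                         p ⊢ elementName W c k ≐ elementName W d l
      elementName-cong c≈d (acc k) (acc l) = ≐-ext
        (λ _ ρ h → ∈E h λ { _ ((e , e<c) , _) _ eq →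
          ∈I ((e , <-respʳ c≈d e<c) , _) ≤-refl (≐-trans eq (elementName-cong ≈.refl (k e<c) _)) })
        (λ _ ρ h → ∈E h λ { _ ((e , e<d) , _) _ eq →
          let e<c = <-respʳ (≈.sym c≈d) e<d in
          ∈I ((e , e<c) , _) ≤-refl (≐-trans eq (≐-sym (elementName-cong ≈.refl (k e<c) _))) })

      elementName-<I : ∀ {c d} → c < d → (k : Acc _<_ c) (l : Acc _<_ d) →
                       p ⊢ elementName W c k ∈ elementName W d l
      elementName-<I c<d k (acc l) =
        ∈I ((_ , c<d) , _) ≤-refl (elementName-cong ≈.refl k (l c<d))

      elementName-<E : ∀ {d} (l : Acc _<_ d) → p ⊢ σ ∈ elementName W d l →
                       (∀ {q} → q ≤ p → ∀ c → c < d → q ⊢ σ ≐ element c → q ⊢ χ) → p ⊢ χ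
      elementName-<E (acc l) h f = ∈E h λ { q≤p ((c , c<d) , _) _ eq →
        f q≤p c c<d (≐-trans eq (elementName-cong ≈.refl (l c<d) _)) }

    element-cong : ∀ {c d} → c ≈ d → p ⊢ element c ≐ element d
    element-cong c≈d = elementName-cong c≈d _ _

    element-<I : ∀ {c d} → c < d → p ⊢ element c ∈ element d
    element-<I c<d = elementName-<I c<d _ _

    element-<E : ∀ {d} → p ⊢ σ ∈ element d →
                 (∀ {q} → q ≤ p → ∀ c → c < d → q ⊢ σ ≐ element c → q ⊢ χ) → p ⊢ χ
    element-<E = elementName-<E _

    checkI : ∀ {c} → p ⊢ element c ∈ check W
    checkI = ∈I (_ , _) ≤-refl ≐-refl

    checkE : p ⊢ σ ∈ check W → (∀ {q} → q ≤ p → ∀ c → q ⊢ σ ≐ element c → q ⊢ χ) → p ⊢ χ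
    checkE h f = ∈E h λ { q≤p (c , _) _ eq → f q≤p c eq }

    private
      -- Descent: an element of itself is forced equal to some smaller `d`, which is then an element
      -- of itself.
      element-irreflexive : ∀ {c} → Acc _<_ c → ¬ (p ⊢ element c ∈ element c)
      element-irreflexive (acc k) h = ¬falsum (element-<E h λ _ d d<c eq →
        ⊥-elim (element-irreflexive (k d<c) (∈-congʳ eq (element-<I d<c))))

    element-injective : ∀ {c d} → p ⊢ element c ≐ element d → c ≈ d
    element-injective {c = c} {d} eq with compare c d
    ... | tri< c<d _ _ = ⊥-elim (element-irreflexive (<-wellFounded c)
                                  (∈-congʳ (≐-sym eq) (element-<I c<d)))
    ... | tri≈ _ c≈d _ = c≈d
    ... | tri> _ _ d<c = ⊥-elim (element-irreflexive (<-wellFounded d)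
                                  (∈-congʳ eq (element-<I d<c)))

    check-ordinal : p ⊢ IsOrdinal (check W)
    check-ordinal = ∧I
      (allInI λ _ x x∈ → allInI λ q≤p y y∈ → checkE (x∈ ↓ q≤p) λ r≤q c x≐ →
        element-<E (∈-congʳ x≐ (y∈ ↓ r≤q)) λ _ d _ y≐ → ∈-congˡ (≐-sym y≐) checkI)
      (allInI λ _ x x∈ → allInI λ q≤p y y∈ → checkE (x∈ ↓ q≤p) λ r≤q c x≐ →
        checkE (y∈ ↓ r≤q) λ r′≤r d y≐ → trichotomy (x≐ ↓ r′≤r) y≐)
      where
      trichotomy : ∀ {c d} → p ⊢ x ≐ element c → p ⊢ y ≐ element d → p ⊢ x ∈ y ∨ x ≐ y ∨ y ∈ x
      trichotomy {c = c} {d} x≐ y≐ with compare c d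
      ... | tri< c<d _ _ = ∨I₁ (∈-congˡ (≐-sym x≐) (∈-congʳ (≐-sym y≐) (element-<I c<d)))
      ... | tri≈ _ c≈d _ = ∨I₂ (∨I₁ (≐-trans x≐ (≐-trans (element-cong c≈d) (≐-sym y≐))))
      ... | tri> _ _ d<c = ∨I₂ (∨I₂ (∈-congˡ (≐-sym y≐) (∈-congʳ (≐-sym x≐) (element-<I d<c))))

  -- The form in which no new countable sequences are added. Step `n` of a descending chain realises
  -- some `Q n γ` if it can, and below a lower bound no other value remains possible. If nothing can
  -- be realised, `y n` is junk.
  decide : IsσComplete P → {Γ : Set} → Γ → (Q : ℕ → Γ → Condition → Set₁) →
           (∀ {n γ q r} → r ≤ q → Q n γ q → Q n γ r) →
           (∀ {n γ γ′ r} → Q n γ r → Q n γ′ r → γ ≡ γ′) →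
           ∀ p → ∃[ q ] (q ≤ p × Σ[ y ∈ (ℕ → Γ) ] (∀ {n γ r} → r ≤ q → Q n γ r → γ ≡ y n))
  decide complete {Γ} γ₀ Q Q-mono Q-unique p = bound , bound≤ 0 , (λ n → value (decision n)) ,
    λ {n} {γ} {r} r≤q k → decided n (decision n) (Q-mono ≤-refl k)
      (≤-trans r≤q (bound≤ n)) (≤-trans r≤q (bound≤ (suc n)))
    where
    Decides : ℕ → Condition → Set₁
    Decides n q = ∃[ r ] (r ≤ q × ∃[ γ ] Q n γ r)

    step : ∀ {n q} → Dec (Decides n q) → Condition
    step (yes (r , _))  = r
    step {q = q} (no _) = q

    value : ∀ {n q} → Dec (Decides n q) → Γ
    value (yes (_ , _ , γ , _)) = γ
    value (no _)                = γ₀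

    step≤ : ∀ {n q} (d : Dec (Decides n q)) → step d ≤ q
    step≤ (yes (_ , r≤q , _)) = r≤q
    step≤ (no _)              = ≤-refl

    decided : ∀ n {q γ r} (d : Dec (Decides n q)) → Q n γ r → r ≤ q → r ≤ step d → γ ≡ value d
    decided n (yes (_ , _ , _ , k)) k′ _ r≤ = Q-unique k′ (Q-mono r≤ k)
    decided n (no ¬d)               k′ r≤q _ = ⊥-elim (¬d (_ , r≤q , _ , k′))

    chain : ℕ → Condition
    decision : ∀ n → Dec (Decides n (chain n))
    chain zero    = p
    chain (suc n) = step (decision n)
    decision n = em₁

    limit : ∃[ q ] (∀ n → q ≤ chain n)
    limit = complete chain (λ n → step≤ (decision n))

    bound = proj₁ limit
    bound≤ = proj₂ limit

-- Names of ω and injections of initial segments.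

module Skeletons (em₁ : ExcludedMiddle (lsuc 0ℓ)) (ext₁ : Extensionality (lsuc 0ℓ) (lsuc 0ℓ))
                 (P : Poset 0ℓ 0ℓ 0ℓ) where

  open Classical em₁ ext₁
  open ForcingLogic em₁ P
  open Poset P using (_≤_) renaming (Carrier to Condition; refl to ≤-refl; trans to ≤-trans)
  open Forcing P

  private variable
    p q r : Condition
    σ x y z a b : Name

  ω : WellOrder
  ω = record { strictTotalOrder = ℕ.<-strictTotalOrder ; <-wellFounded = ℕ.<-wellFounded }

  numeral : ℕ → Name
  numeral = element ω

  numeral-discrete : Discrete numeral
  numeral-discrete = element-injective ω

  numeral-suc : ∀ n → p ⊢ ∀[ w ] (w ∈ numeral (suc n) ⇔ w ∈ numeral n ∨ w ≐ numeral n)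
  numeral-suc n = allI λ w → ⇔I
    (λ _ h → element-<E ω h λ { _ m (s≤s m≤n) w≐ → case ℕ.m≤n⇒m<n∨m≡n m≤n of λ
      { (inj₁ m<n)  → ∨I₁ (∈-congˡ (≐-sym w≐) (element-<I ω m<n))
      ; (inj₂ refl) → ∨I₂ w≐ } })
    (λ _ h → ∨E h
      (λ _ h → element-<E ω h λ _ m m<n w≐ → ∈-congˡ (≐-sym w≐) (element-<I ω (ℕ.m<n⇒m<1+n m<n)))
      (λ _ w≐ → ∈-congˡ (≐-sym w≐) (element-<I ω (ℕ.n<1+n n))))

  numeral-zero : ¬ (p ⊢ σ ∈ numeral 0)
  numeral-zero h = ¬falsum (element-<E ω h λ _ _ ())

  check-ω : p ⊢ Is-ω (check ω)
  check-ω = ∧I check-inductive (allI λ b → ⇒I λ _ ind → allInI λ q≤p x x∈ →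
      checkE ω x∈ λ r≤q n x≐ → ∈-congˡ (≐-sym x≐) (numeral∈ ind n ↓ q≤p ↓ r≤q))
    where
    check-inductive : p ⊢ IsInductive (check ω)
    check-inductive = ∧I
      (exInI (numeral 0) (checkI ω) (allI λ x → ¬I λ _ → numeral-zero))
      (allInI λ _ x x∈ → checkE ω x∈ λ _ n x≐ → exInI (numeral (suc n)) (checkI ω)
        (allI λ w → ⇔I
          (λ q≤p h → ∨E (⇒E (∧E₁ (allE (numeral-suc n) w)) h)
            (λ r≤q k → ∨I₁ (∈-congʳ (≐-sym x≐ ↓ q≤p ↓ r≤q) k))
            (λ r≤q k → ∨I₂ (≐-trans k (≐-sym x≐ ↓ q≤p ↓ r≤q))))
          (λ q≤p h → ⇒E (∧E₂ (allE (numeral-suc n) w)) (∨E h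
            (λ r≤q k → ∨I₁ (∈-congʳ (x≐ ↓ q≤p ↓ r≤q) k))
            (λ r≤q k → ∨I₂ (≐-trans k (x≐ ↓ q≤p ↓ r≤q)))))))

    numeral∈ : p ⊢ IsInductive b → ∀ n → p ⊢ numeral n ∈ b
    numeral∈ ind zero = exInE (∧E₁ ind) λ _ z z∈ empty → ∈-congˡ
      (≐-ext (λ q≤p ρ k → ⊥-elim (¬E (allE empty ρ ↓ q≤p) k))
             (λ _ ρ k → ⊥-elim (numeral-zero k))) z∈
    numeral∈ ind (suc n) = exInE (allInE (∧E₂ ind) (numeral∈ ind n)) λ _ y y∈ succ → ∈-congˡ
      (≐-ext (λ q≤p ρ k → ⇒E (∧E₂ (allE (numeral-suc n) ρ)) (⇒E (∧E₁ (allE succ ρ ↓ q≤p)) k))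
             (λ q≤p ρ k → ⇒E (∧E₂ (allE succ ρ ↓ q≤p)) (⇒E (∧E₁ (allE (numeral-suc n) ρ)) k))) y∈

  module Skeleton (W : WellOrder) where
    open WellOrder W using (Carrier; _<_)
    open StrictTotalOrder (WellOrder.strictTotalOrder W) using ()
      renaming (<-respˡ-≈ to <-respˡ; module Eq to ≈)
    open Representative ∣ W ∣ public using (Rep; toRep; Rep-≡; rep-≈)

    ι : Rep → Name
    ι t = element W (proj₁ t)

    ι-discrete : Discrete ι
    ι-discrete eq = Rep-≡ (element-injective W eq)

    ι∈check : ∀ t → p ⊢ ι t ∈ check W
    ι∈check t = checkI W

    ι-toRep : ∀ {c} → p ⊢ σ ≐ element W c → p ⊢ σ ≐ ι (toRep c)
    ι-toRep {c = c} eq = ≐-trans eq (element-cong W (≈.sym (rep-≈ c)))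

    ι-enumerates : Enumerates p (check W) ι
    ι-enumerates _ h f = checkE W h λ r≤q c σ≐ → f r≤q (toRep c) (ι-toRep σ≐)

    module _ {J : Set} {t : J → Name} (t-discrete : Discrete t) (j₀ : J) where

      private
        Injective : (c : Carrier) → ((d : Carrier) → d < c → J) → Set
        Injective c h = ∀ {d d′} (l : d < c) (l′ : d′ < c) → h d l ≡ h d′ l′ → d ≈.≈ d′

        -- `injects` takes a map on all representatives. The junk value `j₀` is harmless, as
        -- injectivity is asked only at indices forced into the set.
        total : ∀ {c} → ((d : Carrier) → d < c → J) → (s : Rep) → Dec (proj₁ s < c) → J
        total h s (yes s<c) = h (proj₁ s) s<c
        total h s (no _)    = j₀

        total-injective : ∀ {c} h → Injective c h →
                          {s s′ : Rep} → proj₁ s < c → proj₁ s′ < c →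
                          (d : Dec (proj₁ s < c)) (d′ : Dec (proj₁ s′ < c)) →
                          total h s d ≡ total h s′ d′ → s ≡ s′
        total-injective h h-injective _   _    (yes l) (yes l′) eq = Rep-≡ (h-injective l l′ eq)
        total-injective h h-injective s<c _    (no ¬l) _        _  = ⊥-elim (¬l s<c)
        total-injective h h-injective _   s′<c (yes _) (no ¬l)  _  = ⊥-elim (¬l s′<c)

        below-c : ∀ {c} (s : Rep) → p ⊢ x ≐ element W c → p ⊢ ι s ∈ x → proj₁ s < c
        below-c s x≐ s∈ = extract λ ¬lt → element-<E W (∈-congʳ x≐ s∈) λ _ d d<c s≐ →
          ⊥-elim (¬lt (<-respˡ (≈.sym (element-injective W s≐)) d<c))

      -- Injections of the ground model survive in the extension. So this clause of being a cardinal
      -- successor carries over, and only the non-injection needs the combinatorics of the poset.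
      segment-injects : (∀ {p} j → p ⊢ t j ∈ b) →
                        (∀ c → ∃[ h ] Injective c h) → p ⊢ ∀[ x ∈ check W ] InjectsInto x b
      segment-injects into injections = allInI λ _ x x∈ → checkE W x∈ λ _ c x≐ →
        let h , h-injective = injections c in
        injects (λ s → total h s em)
          (λ q≤p σ∈ f → element-<E W (∈-congʳ (x≐ ↓ q≤p) σ∈) λ r≤q d _ σ≐ →
            f r≤q (toRep d) (ι-toRep σ≐))
          ι-discrete t-discrete (λ _ _ _ → into _)
          (λ q≤p {i} {j} i∈ j∈ → total-injective h h-injective
            (below-c i (x≐ ↓ q≤p) i∈) (below-c j (x≐ ↓ q≤p) j∈) em em)

-- Ground-model cardinality of colours and points.

module Theorem
  (em₁ : ExcludedMiddle (lsuc 0ℓ)) (ext₁ : Extensionality (lsuc 0ℓ) (lsuc 0ℓ))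
  (ω₁ ω₂ : WellOrder) (isω₁ : Isω₁ ω₁) (isω₂ : Isω₂ ω₁ ω₂) (ch : CH ω₁)
  (κ : WellOrder) (ω₂≼κ : ∣ ω₂ ∣ ≼ ∣ κ ∣) where

  open Classical em₁ ext₁

  module R₁ = Representative ∣ ω₁ ∣
  module R₂ = Representative ∣ ω₂ ∣
  module Rκ = Representative ∣ κ ∣

  Col K : Set
  Col = R₁.Rep
  K   = Rκ.Rep

  open Bijection ch using ()
    renaming (to to enumerate; injective to enumerate-injective
             ; strictlySurjective to enumerate-onto)

  enumerate-injective′ : ∀ {c d} → Setoid._≈_ ∣ ω₁ ∣ (enumerate c) (enumerate d) → c ≡ d
  enumerate-injective′ eq = ext (enumerate-injective eq)

  Col-coded : Coded Col
  Col-coded = (λ t → proj₁ (enumerate-onto (proj₁ t))) , λ {s} {t} eq → R₁.Rep-≡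
    (≈.trans (≈.sym (proj₂ (enumerate-onto (proj₁ s))))
      (≈.trans (≈.reflexive (cong enumerate eq)) (proj₂ (enumerate-onto (proj₁ t)))))
    where module ≈ = Setoid ∣ ω₁ ∣

  ω₂-large : ¬ SmallImage {I = R₂.Rep} id
  ω₂-large (h , h-injective) = proj₁ isω₂
    (R₂.Rep-injection ∣ ω₁ ∣ (enumerate ∘ h) (h-injective ∘ enumerate-injective′))

  ω₁-uncountable : (y : ℕ → Col) → ∃[ t ] (∀ n → t ≢ y n)
  ω₁-uncountable y = decidable-stable em λ ¬w →
    let hit : ∀ t → ∃[ n ] t ≡ y n
        hit t = decidable-stable em λ ¬hit → ¬w (t , λ n eq → ¬hit (n , eq))
    in proj₁ isω₁ (R₁.Rep-injection (≡-setoid ℕ) (proj₁ ∘ hit)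
         (λ {s} {t} eq → trans (proj₂ (hit s)) (trans (cong y eq) (sym (proj₂ (hit t))))))

  abstract
    K-uncountable : (x : ℕ → K) → ∃[ α ] (∀ n → x n ≢ α)
    K-uncountable x = decidable-stable em λ ¬w →
      let hit : ∀ α → ∃[ n ] x n ≡ α
          hit α = decidable-stable em λ ¬hit → ¬w (α , λ n eq → ¬hit (n , eq))
          embed = Rκ.toRep ∘ Injection.to ω₂≼κ ∘ proj₁
      in ω₂-large (code coded-ℕ ∘ proj₁ ∘ hit ∘ embed , λ {s} {t} eq →
           R₂.Rep-≡ (Injection.injective ω₂≼κ (Rκ.toRep-injective
             (trans (sym (proj₂ (hit (embed s))))
               (trans (cong x (code-injective coded-ℕ eq)) (proj₂ (hit (embed t))))))))

    K-inhabited : K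
    K-inhabited = decidable-stable em λ ¬k → ω₂-large
      ((λ _ _ → true) , λ {γ} → ⊥-elim (¬k (Rκ.toRep (Injection.to ω₂≼κ (proj₁ γ)))))

    distinct⇒injective : {f : ℕ → K} → (∀ {m n} → m ℕ.< n → f m ≢ f n) → ∀ {m n} → f m ≡ f n → m ≡ n
    distinct⇒injective distinct {m} {n} eq with ℕ.<-cmp m n
    ... | tri< m<n _ _ = ⊥-elim (distinct m<n eq)
    ... | tri≈ _ m≡n _ = m≡n
    ... | tri> _ _ n<m = ⊥-elim (distinct n<m (sym eq))

    -- The values of `base` before `n`, latest first, followed by a junk constant. So `base m`
    -- stands in `earlier n` at position `n ∸ suc m`.
    earlier : ℕ → ℕ → K
    earlier zero    = λ _ → K-inhabited
    earlier (suc n) = proj₁ (K-uncountable (earlier n)) ◂ earlier n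

    base : ℕ → K
    base n = proj₁ (K-uncountable (earlier n))

    base-injective : ∀ {m n} → base m ≡ base n → m ≡ n
    base-injective = distinct⇒injective λ {m} {n} m<n eq →
      proj₂ (K-uncountable (earlier n)) (n ∸ suc m)
        (trans (cong (λ k → earlier k (n ∸ suc m)) (sym (ℕ.m∸n+n≡m m<n)))
               (trans (occurs (n ∸ suc m) m) eq))
      where
      occurs : ∀ d m → earlier (d + suc m) d ≡ base m
      occurs zero    m = refl
      occurs (suc d) m = occurs d m

  c₀ : Col
  c₀ = R₁.toRep (enumerate λ _ → false)

  open Conditions em₁ ext₁ K Col c₀ base base-injective public
  open Cond
  open _⊑_
  open Poset poset using () renaming (Carrier to Condition)
  open ForcingLogic em₁ poset public
  open Skeletons em₁ ext₁ poset
  open Forcing poset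
  module S₁ = Skeleton ω₁
  module S₂ = Skeleton ω₂
  module Sκ = Skeleton κ
  open Sκ using (ι)

  private variable
    p q r s u : Cond
    A B R x y z ξ f σ : Name
    α β α′ β′ : K
    φ : Formula Name

  -- Completeness and the chain condition.

  complete : IsσComplete poset
  complete P decreasing = limit , limit-⊑
    where open Limit P decreasing

  -- The map `t` makes the twins agree on further coded data, such as the positions of chosen
  -- points.
  twins : {I J T : Set} (f : I → J) → ¬ SmallImage f → (q : I → Cond) (t : I → T) → Coded T →
          ∃[ i ] ∃[ j ] (f i ≢ f j × t i ≡ t j × Twins (q i) (q j))
  twins f large q t t-coded =
    let i , j , i≢j , eq , shared = Δ-system f large (point ∘ q) (λ i → type (q i) , t i)
                                      (coded-× (Type-coded Col-coded) t-coded)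
    in i , j , i≢j , cong proj₂ eq ,
       record { sameType = cong proj₁ eq ; sharedˡ = λ {m} {n} → shared m n }

  twins-compatible : Twins q s → Compatible poset q s
  twins-compatible tw =
    let u , u⊑p , u⊑s , _ =
          amalgamate tw ⊑-refl (λ _ _ → c₀) (λ _ _ → refl) (λ β → β , λ _ _ → refl)
    in u , u⊑p , u⊑s

  -- The edge has to be new to `p` and to `s` but may be coloured in `q`, which only certifies that
  -- `p` and `s` fit together. Hence `u` is made to extend `p` instead of `q`.
  realise : Twins q s → q ⊑ p → Dom s α → ¬ Dom p α → Dom p β → ¬ Dom s β → ∀ η →
            ∃[ u ] (u ⊑ p × u ⊑ s × colour u α β ≡ η)
  realise {q} {s} {p} {α₀} {β₀} tw q⊑p α₀∈s α₀∉p β₀∈p β₀∉s η =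
    let u , u⊑p , u⊑s , cross = amalgamate tw q⊑p e e-sym e-almost
    in u , u⊑p , u⊑s , trans (cross α₀∉p β₀∉s) e-edge
    where
    Edge : K → K → Set
    Edge α β = (α ≡ α₀ × β ≡ β₀) ⊎ (α ≡ β₀ × β ≡ α₀)

    e : K → K → Col
    e α β = if does (em {Edge α β}) then η else c₀

    e-edge : e α₀ β₀ ≡ η
    e-edge = cong (if_then η else c₀) (dec-true em (inj₁ (refl , refl)))

    e-no-edge : ∀ {α β} → ¬ Edge α β → e α β ≡ c₀
    e-no-edge ¬edge = cong (if_then η else c₀) (dec-false em ¬edge)

    flip : ∀ {α β} → Edge α β → Edge β α
    flip (inj₁ (a , b)) = inj₂ (b , a)
    flip (inj₂ (a , b)) = inj₁ (b , a)

    e-sym : ∀ α β → e α β ≡ e β α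
    e-sym α β = cong (if_then η else c₀) (does-cong flip flip em em)

    α₀≢β₀ : α₀ ≢ β₀
    α₀≢β₀ eq = α₀∉p (subst (Dom p) (sym eq) β₀∈p)

    e-almost : ∀ β → ∃[ α₁ ] (∀ α → α ≢ α₁ → e α β ≡ c₀)
    -- The exception for `β₀` is `α₀`. For any other point it is `β₀`, which matters only if that
    -- point is `α₀`.
    e-almost β = [ (λ β≡β₀ → α₀ , λ α α≢α₀ → e-no-edge
                     [ α≢α₀ ∘ proj₁ , (λ (_ , β≡α₀) → α₀≢β₀ (trans (sym β≡α₀) β≡β₀)) ]′) ,
                   (λ β≢β₀ → β₀ , λ α α≢β₀ → e-no-edge [ β≢β₀ ∘ proj₂ , α≢β₀ ∘ proj₁ ]′)
                 ]′ (toSum (em {β ≡ β₀}))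

  ω₂-cc : Isω₂-cc poset ω₁
  ω₂-cc A antichain = inject (decidable-stable em λ large →
      no-twins (twins id large (proj₁ ∘ proj₁) (λ _ → 0) coded-ℕ))
    where
    open Representative (subsetoid (Poset.Eq.setoid poset) A)

    inject : SmallImage {I = Rep} id → subsetoid (Poset.Eq.setoid poset) A ≼ ∣ ω₁ ∣
    inject (h , h-injective) =
      Rep-injection ∣ ω₁ ∣ (enumerate ∘ h) (h-injective ∘ enumerate-injective′)

    no-twins : ¬ (∃[ i ] ∃[ j ] (i ≢ j × 0 ≡ 0 × Twins (proj₁ (proj₁ i)) (proj₁ (proj₁ j))))
    no-twins ((i , _) , (j , _) , i≢j , _ , tw) =
      antichain (proj₂ i) (proj₂ j) (i≢j ∘ Rep-≡) (twins-compatible tw)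

  -- Preservation of ω₁ and ω₂.

  collide : (q : R₂.Rep → Cond) (c : R₂.Rep → 𝒞) →
            ∃[ γ ] ∃[ γ′ ] (γ ≢ γ′ × c γ ≡ c γ′ × Compatible poset (q γ) (q γ′))
  collide q c =
    let γ , γ′ , γ≢γ′ , eq , tw = twins id ω₂-large q c coded-𝒞
    in γ , γ′ , γ≢γ′ , eq , twins-compatible tw

  -- Read `Q n t r` as: `r` forces a partial map on ω to send `n` to `t`. By `decide` the possible
  -- values below some condition form a countable ground-model set, which misses a colour.
  uncovered : (Q : ℕ → Col → Cond → Set₁) →
              (∀ {n t q r} → r ⊑ q → Q n t q → Q n t r) →
              (∀ {n t t′ r} → Q n t r → Q n t′ r → t ≡ t′) →
              ∀ p → ¬ (∀ {q} → q ⊑ p → ∀ t → ¬ (∀ {r} → r ⊑ q → ∀ n → ¬ Q n t r))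
  uncovered Q Q-mono Q-unique p covered =
    let q , q⊑p , y , decided = decide complete c₀ Q Q-mono Q-unique p
        t , t∉y = ω₁-uncountable y
    in covered q⊑p t λ r⊑q n k → t∉y n (decided r⊑q k)

  ω₁-preserved : ¬ (p ⊢ InjectsInto (check ω₁) (check ω))
  ω₁-preserved h with exE∃ h
  ... | p , _ , f , k = uncovered
    (λ n t r → r ⊑ p × (r ⊢ Maps f (S₁.ι t) (numeral n)))
    (λ r⊑q (q⊑p , m) → ⊑-trans r⊑q q⊑p , m ↓ r⊑q)
    (λ (r⊑p , m) (_ , m′) → S₁.ι-discrete (injective-unique (∧E₂ k ↓ r⊑p) m m′))
    p λ q⊑p t ¬Q → ¬falsum (function-total (∧E₁ k ↓ q⊑p) (S₁.ι∈check t) λ r⊑q y y∈ m →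
      checkE ω y∈ λ r′⊑r n y≐ → ⊥-elim (¬Q (⊑-trans r′⊑r r⊑q) n
        (⊑-trans r′⊑r (⊑-trans r⊑q q⊑p) , maps-cong ≐-refl y≐ (m ↓ r′⊑r))))

  -- For each `γ` some condition decides the value of `f`. Two of these conditions are compatible
  -- and decide the same value, so a common extension refutes injectivity.
  ω₂-preserved : ¬ (p ⊢ InjectsInto (check ω₂) (check ω₁))
  ω₂-preserved h with exE∃ h
  ... | p , _ , f , k =
    let γ , γ′ , γ≢γ′ , eq , u , u⊑ , u⊑′ = collide (λ γ → proj₁ (value γ))
          (λ γ → code Col-coded (proj₁ (proj₂ (proj₂ (value γ)))))
        _ , q⊑p , t , m    = value γ
        _ , _   , t′ , m′  = value γ′
    in γ≢γ′ (S₂.ι-discrete (injective-unique (∧E₂ k ↓ ⊑-trans u⊑ q⊑p) (m ↓ u⊑)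
         (subst (λ t → u ⊢ Maps f (S₂.ι γ′) (S₁.ι t))
           (sym (code-injective Col-coded {t} {t′} eq)) (m′ ↓ u⊑′))))
    where
    value : ∀ γ → ∃[ q ] (q ⊑ p × ∃[ t ] (q ⊢ Maps f (S₂.ι γ) (S₁.ι t)))
    value γ = extract₁ λ ¬w → function-total (∧E₁ k) (S₂.ι∈check γ) λ q⊑p y y∈ m →
      S₁.ι-enumerates ⊑-refl y∈ λ r⊑q t y≐ →
      ⊥-elim (¬w (_ , ⊑-trans r⊑q q⊑p , t , maps-cong ≐-refl y≐ (m ↓ r⊑q)))

  check-ω₁ : p ⊢ Is-CardinalSuccessor (check ω) (check ω₁)
  check-ω₁ = ∧I (check-ordinal ω₁) (∧I (¬I λ _ → ω₁-preserved)
    (S₁.segment-injects numeral-discrete 0 (λ _ → checkI ω) λ c →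
      (λ d d<c → Injection.to (proj₂ isω₁ c) (d , d<c)) ,
      λ _ _ → Injection.injective (proj₂ isω₁ c)))

  check-ω₂ : p ⊢ Is-CardinalSuccessor (check ω₁) (check ω₂)
  check-ω₂ = ∧I (check-ordinal ω₂) (∧I (¬I λ _ → ω₂-preserved)
    (S₂.segment-injects S₁.ι-discrete c₀ S₁.ι∈check λ c →
      (λ d d<c → S₁.toRep (Injection.to (proj₂ isω₂ c) (d , d<c))) ,
      λ _ _ → Injection.injective (proj₂ isω₂ c) ∘ R₁.toRep-injective))

  -- The generic colouring.

  edge : K → K → Name
  edge α β = upair (ι α) (ι β)

  pairs : Name
  pairs = name (Σ[ α ∈ K ] Σ[ β ∈ K ] (α ≢ β × Cond))
               (λ (α , β , _) → edge α β) (λ (_ , _ , _ , c) → c)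

  -- The union of the colourings in the generic filter: each condition tags its own edges. An edge
  -- is listed in both orders, which `symmetric` reconciles.
  colouring : Name
  colouring = name (Σ[ c ∈ Cond ] Σ[ α ∈ K ] Σ[ β ∈ K ] (α ≢ β × Dom c α × Dom c β))
                   (λ (c , α , β , _) → opair (edge α β) (S₁.ι (colour c α β))) proj₁

  edge-injective : p ⊢ edge α β ≐ edge α′ β′ → (α ≡ α′ × β ≡ β′) ⊎ (α ≡ β′ × β ≡ α′)
  edge-injective {p} {α} {β} {α′} {β′} eq =
    [ (λ α≡α′ → inj₁ (α≡α′ , Sκ.ι-discrete (upair-injectiveʳ (≐-reflexive (cong ι α≡α′)) eq)))
    , (λ α≢α′ → inj₂ (crossed (α≡β′ α≢α′))) ]′ (toSum (em {α ≡ α′}))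
    where
    α≡β′ : α ≢ α′ → α ≡ β′
    α≡β′ α≢α′ = extract λ α≢β′ → ∨E (∈-upairE (∈-congʳ eq (∈-upairˡ ≐-refl)))
      (λ _ k → ⊥-elim (α≢α′ (Sκ.ι-discrete k))) (λ _ k → ⊥-elim (α≢β′ (Sκ.ι-discrete k)))

    crossed : α ≡ β′ → α ≡ β′ × β ≡ α′
    crossed e = e ,
      Sκ.ι-discrete (upair-injectiveʳ (≐-reflexive (cong ι e)) (≐-trans eq upair-comm))

  colouringI : α ≢ β → Dom p α → Dom p β →
               p ⊢ Maps colouring (edge α β) (S₁.ι (colour p α β))
  colouringI α≢β α∈p β∈p = mapsI (∈I (_ , _ , _ , α≢β , α∈p , β∈p) ⊑-refl ≐-refl)

  colouringE : p ⊢ Maps colouring z ξ →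
    (∀ {q} → q ⊑ p → ∀ α β → α ≢ β → Dom q α → Dom q β → q ⊢ z ≐ edge α β →
      q ⊢ ξ ≐ S₁.ι (colour q α β) → q ⊢ φ) → p ⊢ φ
  colouringE {ξ = ξ} h k = ∈E (mapsE h) λ { {q} q⊑p (c , α , β , α≢β , α∈c , β∈c) q⊑c eq →
    k q⊑p α β α≢β (dom q⊑c α∈c) (dom q⊑c β∈c) (opair-injectiveˡ eq)
      (subst (λ t → q ⊢ ξ ≐ S₁.ι t) (sym (coloured q⊑c α∈c β∈c)) (opair-injectiveʳ eq)) }

  colouring-value : p ⊢ Maps colouring (edge α β) ξ → Dom p α → Dom p β →
                    p ⊢ ξ ≐ S₁.ι (colour p α β)
  colouring-value {p} {α} {β} {ξ} h α∈p β∈p =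
    colouringE h λ {q} q⊑p α′ β′ _ _ _ eq ξ≐ → subst (λ t → q ⊢ ξ ≐ S₁.ι t)
      (trans (match q (edge-injective eq)) (coloured q⊑p α∈p β∈p)) ξ≐
    where
    match : ∀ q {α′ β′} → (α ≡ α′ × β ≡ β′) ⊎ (α ≡ β′ × β ≡ α′) → colour q α′ β′ ≡ colour q α β
    match q (inj₁ (e , e′)) = sym (cong₂ (colour q) e e′)
    match q (inj₂ (e , e′)) = trans (sym (cong₂ (colour q) e′ e)) (symmetric q β α)

  pairI : p ⊢ ι α ∈ A → p ⊢ ι β ∈ B → α ≢ β → p ⊢ z ≐ edge α β → p ⊢ z ∈[ A , B ]
  pairI α∈A β∈B α≢β z≐ = exInI _ α∈A (exInI _ β∈B
    (∧I (¬I λ _ eq → α≢β (Sκ.ι-discrete eq)) (≐upair⇒≐❴❵ z≐)))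

  pairE : Enumerates p A ι → Enumerates p B ι → p ⊢ z ∈[ A , B ] →
          (∀ {q} → q ⊑ p → ∀ α β → q ⊢ ι α ∈ A → q ⊢ ι β ∈ B → α ≢ β → q ⊢ z ≐ edge α β → q ⊢ φ) →
          p ⊢ φ
  pairE A-enum B-enum h k =
    exInE h λ q⊑p x x∈ h → A-enum q⊑p x∈ λ q′⊑q α x≐ →
    exInE (h ↓ q′⊑q) λ r⊑q′ y y∈ h → B-enum (⊑-trans r⊑q′ (⊑-trans q′⊑q q⊑p)) y∈ λ r′⊑r β y≐ →
    let r′⊑q′ = ⊑-trans r′⊑r r⊑q′
        x≐′ = x≐ ↓ r′⊑q′
    in k (⊑-trans r′⊑q′ (⊑-trans q′⊑q q⊑p)) α β
         (∈-congˡ x≐′ (x∈ ↓ ⊑-trans r′⊑q′ q′⊑q)) (∈-congˡ y≐ (y∈ ↓ r′⊑r))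
         (λ α≡β → ¬E (∧E₁ h ↓ r′⊑r)
           (≐-trans x≐′ (≐-trans (≐-reflexive (cong ι α≡β)) (≐-sym y≐))))
         (≐-trans (≐❴❵⇒≐upair (∧E₂ h) ↓ r′⊑r) (upair-cong x≐′ y≐))

  pair-function : p ⊢ IsPairFunction colouring (check κ) (check ω₁)
  pair-function = exI pairs (∧I
    (allI λ z → ⇔I
      (λ _ h → ∈E h λ { _ (α , β , α≢β , _) _ z≐ → pairI (Sκ.ι∈check α) (Sκ.ι∈check β) α≢β z≐ })
      (λ _ h → pairE Sκ.ι-enumerates Sκ.ι-enumerates h
        λ _ α β _ _ α≢β z≐ → ∈I (α , β , α≢β , _) ⊑-refl z≐))
    (∧I
      (allInI λ _ z z∈ → ∈E z∈ λ { _ (c , α , β , α≢β , _) _ z≐ →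
        exInI (edge α β) (∈I (α , β , α≢β , _) ⊑-refl ≐-refl)
          (exInI _ (S₁.ι∈check (colour c α β)) (≐opair⇒≐⟨⟩ z≐)) })
      (allInI λ _ x x∈ → ∈E x∈ λ { _ (α , β , α≢β , _) _ x≐ → dense λ {r} r⊑q →
        -- Totality is a density argument: once both end points are in the domain, the colour of the
        -- edge is settled.
        let u = addPoint (addPoint r α) β
            u⊑ = addPoint-⊑ (addPoint r α) β
            u⊑r = ⊑-trans u⊑ (addPoint-⊑ r α)
            α∈u = dom u⊑ (addPoint-dom r α)
            β∈u = addPoint-dom (addPoint r α) β
            x≐u = x≐ ↓ ⊑-trans u⊑r r⊑q
        in u , u⊑r , exInI (S₁.ι (colour u α β)) (S₁.ι∈check (colour u α β)) (∧I
             (maps-cong (≐-sym x≐u) ≐-refl (colouringI α≢β α∈u β∈u))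
             (allInI λ v⊑u y _ → ⇒I λ w⊑v m → let w⊑u = ⊑-trans w⊑v v⊑u in
               ≐-trans
                 (colouring-value (maps-cong (x≐u ↓ w⊑u) ≐-refl m) (dom w⊑u α∈u) (dom w⊑u β∈u))
                 (≐-reflexive (cong S₁.ι (coloured w⊑u α∈u β∈u))))) })))

  -- Every colour appears between large sets.

  subset-enumerates : p ⊢ A ⊆ check κ → Enumerates p A ι
  subset-enumerates A⊆κ q⊑p h = Sκ.ι-enumerates ⊑-refl (allInE (A⊆κ ↓ q⊑p) h)

  -- Uncountability in the form used for both (1) and (2): no condition below `p` confines `A` to a
  -- countable sequence of the ground model.
  Fresh : Cond → Name → Set₁
  Fresh p A = ∀ {q} → q ⊑ p → (x : ℕ → K) →
              ∃[ r ] (r ⊑ q × ∃[ α ] ((∀ n → x n ≢ α) × (r ⊢ ι α ∈ A)))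

  -- If the `x n` covered `A`, the values of `f` at them would cover ω₁, against `uncovered`.
  ω₁-fresh : p ⊢ A ⊆ check κ → p ⊢ IsFunction f A (check ω₁) →
             p ⊢ (∀[ y ∈ check ω₁ ] ∃[ x ∈ A ] Maps f x y) → Fresh p A
  ω₁-fresh {p} {A} {f} A⊆κ function onto {q} q⊑p x = decidable-stable em₁ λ ¬w → uncovered
    (λ n t r → r ⊑ q × (r ⊢ Maps f (ι (x n)) (S₁.ι t)))
    (λ r⊑s (s⊑q , m) → ⊑-trans r⊑s s⊑q , m ↓ r⊑s)
    (λ (r⊑q , m) (_ , m′) →
      S₁.ι-discrete (function-unique (function ↓ ⊑-trans r⊑q q⊑p) m m′))
    q λ r⊑q t ¬Q → ¬falsum
      (exInE (allInE (onto ↓ ⊑-trans r⊑q q⊑p) (S₁.ι∈check t)) λ s⊑r y y∈ m →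
       subset-enumerates A⊆κ (⊑-trans s⊑r (⊑-trans r⊑q q⊑p)) y∈ λ {u} u⊑s α y≐ →
       let u⊑q = ⊑-trans u⊑s (⊑-trans s⊑r r⊑q) in
       ⊥-elim (¬w (_ , u⊑q , α , (λ n xn≡α → ¬Q (⊑-trans u⊑s s⊑r) n
         (u⊑q , maps-cong (≐-trans y≐ (≐-reflexive (cong ι (sym xn≡α)))) ≐-refl (m ↓ u⊑s))) ,
         ∈-congˡ y≐ (y∈ ↓ u⊑s))))

  -- Formulated with `_⊩_∈̇_`, which stays in `Set` as the index type of `SmallImage` must.
  Potential : Cond → Name → Set
  Potential p B = Σ[ β ∈ K ] Σ[ r ∈ Cond ] (r ⊑ p × (r ⊩ ι β ∈̇ B))

  Large : Cond → Name → Set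
  Large p B = ¬ SmallImage {I = Potential p B} proj₁

  -- Each `γ` gets a preimage decided by some condition. If reals coded the preimages, two different
  -- `γ` would share one, with compatible conditions, and `f` would take two values there.
  ω₂-potential : p ⊢ B ⊆ check κ → p ⊢ IsFunction f B (check ω₂) →
                 p ⊢ (∀[ y ∈ check ω₂ ] ∃[ x ∈ B ] Maps f x y) → Large p B
  ω₂-potential {p} {B} {f} B⊆κ function onto (h , h-injective) =
    let γ , γ′ , γ≢γ′ , eq , u , u⊑ , u⊑′ = collide (λ γ → proj₁ (preimage γ))
          (λ γ → h (proj₁ (proj₂ (proj₂ (preimage γ)))))
        r  , r⊑p  , β  , ⟪ lift β∈  ⟫ , m  = preimage γ
        r′ , r′⊑p , β′ , ⟪ lift β′∈ ⟫ , m′ = preimage γ′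
        β≡β′ = h-injective {β , r , r⊑p , β∈} {β′ , r′ , r′⊑p , β′∈} eq
    in γ≢γ′ (S₂.ι-discrete (function-unique (function ↓ ⊑-trans u⊑ r⊑p) (m ↓ u⊑)
         (maps-cong (≐-reflexive (cong ι (sym β≡β′))) ≐-refl (m′ ↓ u⊑′))))
    where
    preimage : ∀ γ → ∃[ r ] (r ⊑ p × ∃[ β ] ((r ⊢ ι β ∈ B) × (r ⊢ Maps f (ι β) (S₂.ι γ))))
    preimage γ = extract₁ λ ¬w →
      exInE (allInE onto (S₂.ι∈check γ)) λ q⊑p x x∈ m →
      subset-enumerates B⊆κ q⊑p x∈ λ r⊑q β x≐ →
      ⊥-elim (¬w (_ , ⊑-trans r⊑q q⊑p , β , ∈-congˡ x≐ (x∈ ↓ r⊑q) , maps-cong x≐ ≐-refl (m ↓ r⊑q)))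

  -- For i = (β , r , …) the condition S i decides a new element a i of A after
  -- P i has put β into B.  Twins S i, S j leave the edge between a j and β i open
  -- in P i and in S j.
  colour-appears : Fresh p A → Large p B → ∀ η →
    ∃[ u ] (u ⊑ p × ∃[ α ] ∃[ β ] (α ≢ β × Dom u α × Dom u β × colour u α β ≡ η ×
                                   (u ⊢ ι α ∈ A) × (u ⊢ ι β ∈ B)))
  colour-appears {p₀} {A} {B} fresh large η = conclusion
    where
    P : Potential p₀ B → Cond
    P (β , r , _) = addPoint r β

    P⊑p₀ : ∀ i → P i ⊑ p₀
    P⊑p₀ (β , r , r⊑p₀ , _) = ⊑-trans (addPoint-⊑ r β) r⊑p₀

    β∈P : ∀ i → Dom (P i) (proj₁ i)
    β∈P (β , r , _) = addPoint-dom r β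

    β∈B : ∀ i → P i ⊢ ι (proj₁ i) ∈ B
    β∈B (β , r , _ , β∈) = ⟪ lift β∈ ⟫ ↓ addPoint-⊑ r β

    new : ∀ i → ∃[ r ] (r ⊑ P i × ∃[ α ] ((∀ n → point (P i) n ≢ α) × (r ⊢ ι α ∈ A)))
    new i = fresh (P⊑p₀ i) (point (P i))

    a : Potential p₀ B → K
    a i = proj₁ (proj₂ (proj₂ (new i)))

    S : Potential p₀ B → Cond
    S i = addPoint (proj₁ (new i)) (a i)

    S⊑P : ∀ i → S i ⊑ P i
    S⊑P i = ⊑-trans (addPoint-⊑ (proj₁ (new i)) (a i)) (proj₁ (proj₂ (new i)))

    new∉P : ∀ i n → point (P i) n ≢ a i
    new∉P i = proj₁ (proj₂ (proj₂ (proj₂ (new i))))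

    a∈S : ∀ i → Dom (S i) (a i)
    a∈S i = addPoint-dom (proj₁ (new i)) (a i)

    β∈S : ∀ i → Dom (S i) (proj₁ i)
    β∈S i = dom (S⊑P i) (β∈P i)

    a∈A : ∀ i → S i ⊢ ι (a i) ∈ A
    a∈A i = proj₂ (proj₂ (proj₂ (proj₂ (new i)))) ↓ addPoint-⊑ (proj₁ (new i)) (a i)

    -- Otherwise `a j` is common to the twins and, the positions being equal, is `a i`, which was
    -- chosen outside `P i`. It may still lie in `S i`, since `a i` and `a j` can coincide; so the
    -- edge is looked for over `P i`.
    a∉P : ∀ i j → Twins (S i) (S j) → proj₁ (a∈S i) ≡ proj₁ (a∈S j) → ¬ Dom (P i) (a j)
    a∉P i j tw eq (m , at) = new∉P i m (trans at (trans (sym (proj₂ (a∈S j)))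
      (trans (sym (Twins.sharedʳ tw {m = proj₁ aj∈Si} {n = proj₁ (a∈S j)}
                    (trans (proj₂ aj∈Si) (sym (proj₂ (a∈S j))))))
      (trans (cong (point (S i)) (sym eq)) (proj₂ (a∈S i))))))
      where
      aj∈Si : Dom (S i) (a j)
      aj∈Si = dom (S⊑P i) (m , at)

    β∉S : ∀ i j → Twins (S i) (S j) → proj₁ (β∈S i) ≡ proj₁ (β∈S j) →
          proj₁ i ≢ proj₁ j → ¬ Dom (S j) (proj₁ i)
    β∉S i j tw eq βi≢βj (n , at) = βi≢βj (trans (sym (proj₂ (β∈S i)))
      (trans (Twins.sharedˡ tw {m = proj₁ (β∈S i)} {n = n} (trans (proj₂ (β∈S i)) (sym at)))
      (trans (cong (point (S j)) eq) (proj₂ (β∈S j)))))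

    Conclusion : Set₁
    Conclusion = ∃[ u ] (u ⊑ p₀ × ∃[ α ] ∃[ β ] (α ≢ β × Dom u α × Dom u β × colour u α β ≡ η ×
                                                  (u ⊢ ι α ∈ A) × (u ⊢ ι β ∈ B)))

    realised : ∀ i j → ¬ Dom (P i) (a j) →
               ∃[ u ] (u ⊑ P i × u ⊑ S j × colour u (a j) (proj₁ i) ≡ η) → Conclusion
    realised i j aj∉P (u , u⊑P , u⊑S , uη) =
      u , ⊑-trans u⊑P (P⊑p₀ i) , a j , proj₁ i ,
      (λ aj≡βi → aj∉P (subst (Dom (P i)) (sym aj≡βi) (β∈P i))) ,
      dom u⊑S (a∈S j) , dom u⊑P (β∈P i) , uη , a∈A j ↓ u⊑S , β∈B i ↓ u⊑P

    fromTwins : ∃[ i ] ∃[ j ] (proj₁ i ≢ proj₁ j ×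
                  (proj₁ (a∈S i) , proj₁ (β∈S i)) ≡ (proj₁ (a∈S j) , proj₁ (β∈S j)) ×
                  Twins (S i) (S j)) → Conclusion
    fromTwins (i , j , βi≢βj , eq , tw) = realised i j (a∉P i j tw (cong proj₁ eq))
      (realise tw (S⊑P i) (a∈S j) (a∉P i j tw (cong proj₁ eq)) (β∈P i)
               (β∉S i j tw (cong proj₂ eq) βi≢βj) η)

    conclusion : Conclusion
    -- Applying `twins` to `proj₁` yields different elements of B; the positions of both chosen
    -- points are added to the type.
    conclusion = fromTwins (twins proj₁ large S (λ i → proj₁ (a∈S i) , proj₁ (β∈S i))
                                  (coded-× coded-ℕ coded-ℕ))

  Equinumerosity : Name → Name → Name → Formula Name
  Equinumerosity f a b =
    IsFunction f a b ∧ IsInjective f ∧ (∀[ y ∈ b ] ∃[ x ∈ a ] Maps f x y)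

  InImage : Name → Name → Name → Formula Name
  InImage A B ξ = ∃[ z ]′ (z ∈[ A , B ] ∧ Maps colouring z ξ)

  appears-in-image : ∀ η → p ⊢ ξ ≐ S₁.ι η →
    ∃[ u ] (u ⊑ p × ∃[ α ] ∃[ β ] (α ≢ β × Dom u α × Dom u β × colour u α β ≡ η ×
                                   (u ⊢ ι α ∈ A) × (u ⊢ ι β ∈ B))) →
    ∃[ u ] (u ⊑ p × (u ⊢ InImage A B ξ))
  appears-in-image η ξ≐ (u , u⊑p , α , β , α≢β , α∈u , β∈u , uη , α∈A , β∈B) =
    u , u⊑p , exI (edge α β) (∧I (pairI α∈A β∈B α≢β ≐-refl)
      (maps-cong ≐-refl (≐-trans (≐-reflexive (cong S₁.ι uη)) (≐-sym ξ≐ ↓ u⊑p))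
        (colouringI α≢β α∈u β∈u)))

  colour-in-image : ∀ {f g} → p ⊢ A ⊆ check κ → p ⊢ B ⊆ check κ →
    p ⊢ Equinumerosity f A (check ω₁) → p ⊢ Equinumerosity g B (check ω₂) →
    p ⊢ ξ ∈ check ω₁ → p ⊢ InImage A B ξ
  colour-in-image A⊆κ B⊆κ hA hB ξ∈ = S₁.ι-enumerates ⊑-refl ξ∈ λ q⊑p η ξ≐ → dense λ r⊑q →
    appears-in-image η (ξ≐ ↓ r⊑q) (colour-appears
      (ω₁-fresh A⊆κ (∧E₁ hA) (∧E₂ (∧E₂ hA)) ∘ λ s⊑r → ⊑-trans s⊑r (⊑-trans r⊑q q⊑p))
      (ω₂-potential (B⊆κ ↓ q⊑p ↓ r⊑q) (∧E₁ hB ↓ q⊑p ↓ r⊑q) (∧E₂ (∧E₂ hB) ↓ q⊑p ↓ r⊑q)) η)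

  image-colour : p ⊢ InImage A B ξ → p ⊢ ξ ∈ check ω₁
  image-colour h = exE h λ _ z h → colouringE (∧E₂ h) λ {q} _ α β _ _ _ _ ξ≐ →
    ∈-congˡ (≐-sym ξ≐) (S₁.ι∈check (colour q α β))

  establishes : p ⊢ Establishes colouring (check κ) (check ω₁) (check ω₂)
  establishes = ∧I pair-function (allI λ A → allI λ B → ⇒I λ _ h → allI λ ξ → ⇔I
    (λ q⊑p ξ∈ →
      exE (∧E₁ (∧E₂ (∧E₂ h)) ↓ q⊑p) λ r⊑q _ hA →
      exE (∧E₂ (∧E₂ (∧E₂ h)) ↓ q⊑p ↓ r⊑q) λ s⊑r _ hB →
      colour-in-image (∧E₁ h ↓ q⊑p ↓ r⊑q ↓ s⊑r) (∧E₁ (∧E₂ h) ↓ q⊑p ↓ r⊑q ↓ s⊑r)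
        (hA ↓ s⊑r) hB (ξ∈ ↓ r⊑q ↓ s⊑r))
    (λ _ → image-colour))

  -- No uncountable rainbow set.

  countable-injects : p ⊢ R ⊆ check κ → (x : ℕ → K) →
    (∀ {q} → q ⊑ p → ∀ α → q ⊢ ι α ∈ R → ∃[ n ] x n ≡ α) → p ⊢ InjectsInto R (check ω)
  countable-injects R⊆κ x hit = injects (λ α → position (em {∃[ n ] x n ≡ α}))
      (subset-enumerates R⊆κ) Sκ.ι-discrete numeral-discrete (λ _ _ _ → checkI ω)
      (λ q⊑p i∈ j∈ eq → trans (sym (correct em (hit q⊑p _ i∈)))
                          (trans (cong x eq) (correct em (hit q⊑p _ j∈))))
    where
    position : ∀ {α} → Dec (∃[ n ] x n ≡ α) → ℕ
    position (yes (n , _)) = n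
    position (no _)        = 0

    correct : ∀ {α} (d : Dec (∃[ n ] x n ≡ α)) → ∃[ n ] x n ≡ α → x (position d) ≡ α
    correct (yes (_ , eq)) _ = eq
    correct (no ¬w)        w = ⊥-elim (¬w w)

  -- Otherwise some condition confines `R` to a ground-model sequence, and positions in it inject
  -- `R` into ω.
  uncountable-fresh : p ⊢ R ⊆ check κ → p ⊢ ¬′ InjectsInto R (check ω) → Fresh p R
  uncountable-fresh R⊆κ uncountable q⊑p x = decidable-stable em₁ λ ¬w →
    ¬E (uncountable ↓ q⊑p) (countable-injects (R⊆κ ↓ q⊑p) x λ r⊑q α α∈ →
      decidable-stable em λ ¬hit → ¬w (_ , r⊑q , α , (λ n eq → ¬hit (n , eq)) , α∈))

  -- Each element is chosen outside the current domain and put into the next one, so all are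
  -- distinct; the limit condition decides them together.
  infinite-subset : Fresh p R →
    ∃[ q ] (q ⊑ p × Σ[ b ∈ (ℕ → ℕ) ] ((∀ {m n} → point q (b m) ≡ point q (b n) → m ≡ n) ×
                                      (∀ n → q ⊢ ι (point q (b n)) ∈ R)))
  infinite-subset {p} {R} fresh = limit , limit-⊑ 0 , (λ n → proj₁ (α∈limit n)) ,
      (λ {m} {n} eq → distinct⇒injective distinct
        (trans (sym (proj₂ (α∈limit m))) (trans eq (proj₂ (α∈limit n))))) ,
      (λ n → subst (λ γ → limit ⊢ ι γ ∈ R) (sym (proj₂ (α∈limit n))) (α∈R n ↓ limit-⊑ (suc n)))
    where
    chain : ℕ → ∃[ q ] q ⊑ p
    new : ∀ n → ∃[ r ] (r ⊑ proj₁ (chain n) ×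
                        ∃[ α ] ((∀ m → point (proj₁ (chain n)) m ≢ α) × (r ⊢ ι α ∈ R)))
    chain zero    = p , ⊑-refl
    chain (suc n) = let r , r⊑ , α , _ = new n in
      addPoint r α , ⊑-trans (addPoint-⊑ r α) (⊑-trans r⊑ (proj₂ (chain n)))
    new n = fresh (proj₂ (chain n)) (point (proj₁ (chain n)))

    a : ℕ → K
    a n = proj₁ (proj₂ (proj₂ (new n)))

    open Limit (λ n → proj₁ (chain n))
      (λ n → ⊑-trans (addPoint-⊑ (proj₁ (new n)) (a n)) (proj₁ (proj₂ (new n))))

    α∈chain : ∀ n → Dom (proj₁ (chain (suc n))) (a n)
    α∈chain n = addPoint-dom (proj₁ (new n)) (a n)

    α∈R : ∀ n → proj₁ (chain (suc n)) ⊢ ι (a n) ∈ R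
    α∈R n = proj₂ (proj₂ (proj₂ (proj₂ (new n)))) ↓ addPoint-⊑ (proj₁ (new n)) (a n)

    α∈limit : ∀ n → Dom limit (a n)
    α∈limit n = dom (limit-⊑ (suc n)) (α∈chain n)

    distinct : ∀ {m n} → m ℕ.< n → a m ≢ a n
    distinct {m} {n} m<n eq =
      let k , at = dom (antitone m<n) (α∈chain m)
      in proj₁ (proj₂ (proj₂ (proj₂ (new n)))) k (trans at eq)

  -- By the promise, every β in R outside the countable set of the a i is joined to
  -- some a i by an edge of colour C j.  In a rainbow set j determines β, so R is
  -- countable.
  no-rainbow : p ⊢ IsRainbow colouring R → ¬ Fresh p R
  no-rainbow {p} {R} rainbow fresh = fromSubset (infinite-subset fresh)
    where
    fromSubset : ∃[ q ] (q ⊑ p × Σ[ b ∈ (ℕ → ℕ) ]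
                   ((∀ {m n} → point q (b m) ≡ point q (b n) → m ≡ n) ×
                    (∀ n → q ⊢ ι (point q (b n)) ∈ R))) → ⊥
    fromSubset (q , q⊑p , b , b-injective , b∈R) = contradiction
      where
      p′ : Cond
      p′ = addPromise q b b-injective

      p′⊑q : p′ ⊑ q
      p′⊑q = addPromise-⊑ q b b-injective

      p′⊑p : p′ ⊑ p
      p′⊑p = ⊑-trans p′⊑q q⊑p

      a : ℕ → K
      a = support p′ 0

      C : ℕ → Col
      C = allowed p′ 0

      Q : ℕ → K → Cond → Set₁
      Q j β r = r ⊑ p′ × (∀ i → a i ≢ β) × (r ⊢ ι β ∈ R) ×
                ∃[ i ] (Dom r (a i) × Dom r β × colour r (a i) β ≡ C j)

      Q-mono : ∀ {j β r r′} → r′ ⊑ r → Q j β r → Q j β r′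
      Q-mono r′⊑r (r⊑p′ , β∉a , β∈R , i , ai∈ , β∈ , eq) =
        ⊑-trans r′⊑r r⊑p′ , β∉a , β∈R ↓ r′⊑r , i , dom r′⊑r ai∈ , dom r′⊑r β∈ ,
        trans (coloured r′⊑r ai∈ β∈) eq

      Q-unique : ∀ {j β β′ r} → Q j β r → Q j β′ r → β ≡ β′
      Q-unique {j} {β} {β′} {r} (r⊑p′ , β∉a , β∈R , i , ai∈ , β∈ , eq)
                                (_ , β′∉a , β′∈R , i′ , ai′∈ , β′∈ , eq′) =
        -- Both edges have colour `C j`, so they are the same edge. Matching them crosswise would
        -- make `β′` one of the `a i`, which `Q` excludes.
        [ proj₂ , (λ (ai≡β′ , _) → ⊥-elim (β′∉a i ai≡β′)) ]′
        (edge-injective {r} {a i} {β} {a i′} {β′}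
          (⇒E (allE (allE (allE (rainbow ↓ ⊑-trans r⊑p′ p′⊑p) (edge (a i) β)) (edge (a i′) β′))
                    (S₁.ι (colour r (a i) β)))
            (∧I (pairI (b∈R i ↓ ⊑-trans r⊑p′ p′⊑q) β∈R (β∉a i) ≐-refl)
            (∧I (pairI (b∈R i′ ↓ ⊑-trans r⊑p′ p′⊑q) β′∈R (β′∉a i′) ≐-refl)
            (∧I (colouringI (β∉a i) ai∈ β∈)
                (maps-cong ≐-refl (≐-reflexive (cong S₁.ι (trans eq′ (sym eq))))
                  (colouringI (β′∉a i′) ai′∈ β′∈)))))))

      Q-occurs : ∀ {r β} → r ⊑ p′ → (∀ i → a i ≢ β) → r ⊢ ι β ∈ R → ∃[ j ] Q j β (addPoint r β)
      Q-occurs {r} {β} r⊑p′ β∉a β∈R = fromKeeps (keeps-⊑ u⊑p′ 0 (addPoint-dom r β))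
        where
        u⊑p′ : addPoint r β ⊑ p′
        u⊑p′ = ⊑-trans (addPoint-⊑ r β) r⊑p′

        fromKeeps : Keeps (colour (addPoint r β)) a C β → ∃[ j ] Q j β (addPoint r β)
        -- From `N` on there are no exceptions, and one edge is enough.
        fromKeeps (N , keeps) = proj₁ (keeps N ℕ.≤-refl) , u⊑p′ , β∉a , β∈R ↓ addPoint-⊑ r β , N ,
          dom u⊑p′ (support-dom p′ 0 N) , addPoint-dom r β , proj₂ (keeps N ℕ.≤-refl)

      fromFresh : ∀ {t} → t ⊑ p′ → (y : ℕ → K) → (∀ {j β r} → r ⊑ t → Q j β r → β ≡ y j) →
                  ∃[ r ] (r ⊑ t × ∃[ β ] ((∀ n → flatten (a ◂ λ _ → y) n ≢ β) × (r ⊢ ι β ∈ R))) → ⊥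
      fromFresh t⊑p′ y decided (r , r⊑t , β , new , β∈R) = fromOccurrence
        (Q-occurs (⊑-trans r⊑t t⊑p′)
          (λ i eq → new (pair 0 i) (trans (flatten-pair (a ◂ λ _ → y) 0 i) eq)) β∈R)
        where
        fromOccurrence : ∃[ j ] Q j β (addPoint r β) → ⊥
        fromOccurrence (j , k) = new (pair 1 j) (trans (flatten-pair (a ◂ λ _ → y) 1 j)
          (sym (decided {j} {β} (⊑-trans (addPoint-⊑ r β) r⊑t) k)))

      fromDecision : ∃[ t ] (t ⊑ p′ × Σ[ y ∈ (ℕ → K) ] (∀ {j β r} → r ⊑ t → Q j β r → β ≡ y j)) → ⊥
      -- Row 0 of the flattened family lists the `a i` and every later row lists `y`, so the new
      -- element avoids both sequences.
      fromDecision (t , t⊑p′ , y , decided) = fromFresh t⊑p′ y (λ {j} {β} → decided {j} {β})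
        (fresh (⊑-trans t⊑p′ p′⊑p) (flatten (a ◂ λ _ → y)))

      contradiction : ⊥
      contradiction = fromDecision
        (decide complete K-inhabited Q (λ {j} {β} → Q-mono {j} {β}) (λ {j} → Q-unique {j}) p′)

  no-uncountable-rainbow : p ⊢ NoUncountableRainbow colouring (check κ) (check ω)
  no-uncountable-rainbow = ¬I λ _ h → let _ , _ , R , k = exE∃ h in
    no-rainbow (∧E₁ (∧E₂ k)) (uncountable-fresh (∧E₁ k) (∧E₂ (∧E₂ k)))

  exists-colouring : p ⊢ ExistsColouring (check κ)
  exists-colouring = exI (check ω) (exI (check ω₁) (exI (check ω₂)
    (∧I check-ω (∧I check-ω₁ (∧I check-ω₂
      (exI colouring (∧I establishes no-uncountable-rainbow)))))))

theorem2p8 : ExcludedMiddle (lsuc 0ℓ) →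
    Extensionality (lsuc 0ℓ) (lsuc 0ℓ) →
    (ω₁ ω₂ : WellOrder) → Isω₁ ω₁ → Isω₂ ω₁ ω₂ →
    CH ω₁ →
    (κ : WellOrder) → IsCardinal κ → ∣ ω₂ ∣ ≼ ∣ κ ∣ →
    Σ[ P ∈ Poset 0ℓ 0ℓ 0ℓ ]
    ( Poset.Carrier P
    × IsσComplete P
    × Isω₂-cc P ω₁
    × Forcing.V^P⊨_ P (ExistsColouring (Forcing.check P κ)) )
theorem2p8 em₁ ext₁ ω₁ ω₂ isω₁ isω₂ ch κ _ ω₂≼κ =
  poset , initial , complete , ω₂-cc , λ p → forced exists-colouring
  where open Theorem em₁ ext₁ ω₁ ω₂ isω₁ isω₂ ch κ ω₂≼κ
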